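{- For every instance $(G,w,s,T)$ of the single-source many-targets shortest path problem in which at least one target node is reachable from $s$, and for all parameters $i_0\in\mathbb{N}$, $\alpha\ge 1$, $\beta>1$ and every prediction value returned by the prediction subroutine (no matter how inaccurate), the algorithm Dijkstra-Prediction is correct, i.e., it terminates in polynomial time and computes an optimal solution to the problem. Moreover, its worst-case running time is $O(m+n\log n)$, where $n=|V|$ and $m=|E|$.
   Context: Problem (SSMTSP): given a directed graph $G=(V,E)$ with edge weights $w:E\to\mathbb{R}_{\ge 0}$, a source $s\in V$ and a set of target nodes $T\subseteq V$, compute a shortest path from $s$ to any node of $T$, i.e., a path whose length is $D=\min_{t\in T}\delta(t)$, where $\delta(v)$ is the shortest path distance from $s$ to $v$ ($\delta(v)=\infty$ if $v$ is unreachable). It is assumed that some target is reachable from $s$. It suffices to compute the shortest path distances of all nodes $v$ with $\delta(v)\le D$. Algorithm Dijkstra-Prediction. It uses a priority queue $PQ$ implemented as a Fibonacci heap (keyed by tentative distances), a reserve set $R$, tentative distances $d(\cdot)$, a pruning bound $B$ and a prediction $P$. Initially $d(s)=0$, $d(v)=\infty$ for $v\ne s$, $B=\infty$, $P=\infty$, $PQ=\{s\}$, $R=\emptyset$. Main loop: while $PQ$ is nonempty and the minimum key in $PQ$ is at most $P$: (1) remove a node $u$ of minimum tentative distance from $PQ$; if $u\in T$, stop. (2) In each of the first $i_0$ iterations the pair $(d(u),B)$ is appended to a trace $X$; in iteration $i_0$, set $P:=\alpha\cdot\mathrm{Prediction}(X)$, where Prediction is an arbitrary black-box subroutine returning a positive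 real number (its own cost is not counted). (3) For each edge $(u,v)\in E$: let $tent=d(u)+w(u,v)$. If $tent>B$, skip (prune) the edge. Otherwise, if $v\in T$ set $B:=\min\{tent,B\}$; then relax: if $d(v)>tent$, then - if $d(v)=\infty$: insert $v$ with key $tent$ into $PQ$ if $tent\le P$, and into $R$ otherwise; - if $d(v)<\infty$ and $v\notin R$: decrease the key of $v$ in $PQ$ to $tent$; - if $v\in R$: if $tent>P$, $v$ stays in $R$ with key lowered to $tent$; otherwise move $v$ from $R$ to $PQ$ with key $tent$; and set $d(v):=tent$. Whenever the loop condition fails (without having stopped), the procedure Update-Prediction is called: set $P:=\beta P$, and move every node $v\in R$ with $d(v)\le P$ (new value of $P$) and $d(v)\le B$ from $R$ to $PQ$ with key $d(v)$; then the main loop is continued. The reserve set $R$ is stored in unsorted linked lists (buckets): with $P_0$ the first finite prediction value, bucket $i=1,2,\dots$ contains the nodes of $R$ whose tentative distance lies in $(\beta^{i-1}P_0,\beta^iP_0]$. The $i$-th call of Update-Prediction processes bucket $i$.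
   Formalization: Calls of Update-Prediction on empty buckets are not charged, since otherwise no bound in n and m holds (one edge of weight 1, tiny prediction); instead it is stated that every call happens while P < D, so there are at most 1+log_β(D/P₀) calls. -}

module Defs where

open import Algebra.Bundles using (CommutativeRing)
import Algebra.Construct.NaturalChoice.Min as Min
import Algebra.Definitions.RawMonoid as RawMonoidDefs
open import Data.Bool.Base using (if_then_else_)
open import Data.Fin.Base using (Fin)
open import Data.Fin.Subset using (Subset; _∈_; _∉_; _∪_; _─_; _-_; ⁅_⁆; ⊥; ∣_∣)
open import Data.Fin.Subset.Properties using (_∈?_)
open import Data.List.Base using (List; []; _∷_; _++_; foldl; length; map; sum; allFin)
import Data.List.Membership.Propositional as List∈
open import Data.List.Relation.Unary.Unique.Propositional using (Unique)
open import Data.Maybe.Base using () renaming (map to mapMaybe)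
open import Data.Nat as ℕ using (ℕ; zero; suc)
open import Data.Nat.Logarithm using (⌈log₂_⌉)
open import Data.Product.Base using (Σ; ∃; _×_; _,_)
open import Data.Unit.Polymorphic.Base using (⊤)
import Data.Vec.Base as Vec
open import Data.Vec.Functional using (Vector; updateAt)
open import Function.Base using (const; flip)
open import Induction.WellFounded using (Acc)
open import Level using (_⊔_) renaming (suc to lsuc)
open import Relation.Binary.Bundles using (DecTotalOrder)
import Relation.Binary.Construct.Add.Point.Equality as PointEquality
import Relation.Binary.Construct.Add.Supremum.NonStrict as Supremum
open import Relation.Binary.Construct.Closure.ReflexiveTransitive using (Star; ε; _◅_)
open import Relation.Binary.Core using (Rel)
open import Relation.Binary.PropositionalEquality.Core using (_≡_)
open import Relation.Binary.Structures using (IsDecTotalOrder)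
open import Relation.Nullary using (¬_; Dec; does; ¬?; _×-dec_)
open import Relation.Nullary.Construct.Add.Supremum using (_⁺; [_]; ⊤⁺)

------------------------------------------------------------------------
-- Scalars

-- Stands in for ℝ.  The order is decidable because the algorithm branches
-- on comparisons of weights (the real-RAM assumption).  Completeness is not
-- required, so ℝ is one (classical) instance among others.

record ArchimedeanOrderedField c ℓ₁ ℓ₂ : Set (lsuc (c ⊔ ℓ₁ ⊔ ℓ₂)) where
  field
    commutativeRing : CommutativeRing c ℓ₁
  open CommutativeRing commutativeRing public
    using (_≈_; 0#; 1#; +-rawMonoid)
    renaming (Carrier to K; _+_ to _+ᴷ_; _*_ to _*ᴷ_)
  open RawMonoidDefs +-rawMonoid public using () renaming (_×_ to _×ᴷ_)
  infix 4 _≤_ _<_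
  field
    _≤_             : Rel K ℓ₂
    isDecTotalOrder : IsDecTotalOrder _≈_ _≤_
    +-mono-≤        : ∀ {x y} z → x ≤ y → x +ᴷ z ≤ y +ᴷ z
    *-nonneg        : ∀ {x y} → 0# ≤ x → 0# ≤ y → 0# ≤ x *ᴷ y
    1≉0             : ¬ (1# ≈ 0#)
    inverse         : ∀ {x} → ¬ (x ≈ 0#) → ∃ λ y → x *ᴷ y ≈ 1#

  _<_ : Rel K ℓ₂
  x < y = ¬ (y ≤ x)

  field
    archimedean : ∀ {x} y → 0# < x → ∃ λ k → y ≤ k ×ᴷ x

  -- K ∪ {∞}, with ⊤⁺ for ∞
  open PointEquality _≈_ public using () renaming (_≈∙_ to _≈⁺_)
  open Supremum _≤_ public using (_≤⁺_)

  extendedOrder : DecTotalOrder c (c ⊔ ℓ₁) (c ⊔ ℓ₂)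
  extendedOrder = record { isDecTotalOrder = Supremum.≤⁺-isDecTotalOrder _≤_ isDecTotalOrder }

  open DecTotalOrder extendedOrder public using () renaming (_≤?_ to _≤⁺?_)
  open Min (DecTotalOrder.totalOrder extendedOrder) public using () renaming (_⊓_ to _⊓⁺_)

  infixl 6 _+⁺_
  _+⁺_ : K ⁺ → K → K ⁺
  x +⁺ y = mapMaybe (_+ᴷ y) x

  infixl 7 _*⁺_
  _*⁺_ : K → K ⁺ → K ⁺
  x *⁺ y = mapMaybe (x *ᴷ_) y

------------------------------------------------------------------------
-- The problem SSMTSP

module _ {c ℓ₁ ℓ₂} (F : ArchimedeanOrderedField c ℓ₁ ℓ₂) where

  open ArchimedeanOrderedField F

  record Instance : Set (c ⊔ ℓ₂) where
    open List∈ using () renaming (_∈_ to _∈ˡ_)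
    field
      n      : ℕ
      adj    : Fin n → List (Fin n)
      simple : ∀ u → Unique (adj u)
      -- only the values on edges matter
      w      : Fin n → Fin n → K
      w≥0    : ∀ {u v} → v ∈ˡ adj u → 0# ≤ w u v
      s      : Fin n
      T      : Subset n

    V : Set
    V = Fin n

    Edge : Rel V _
    Edge u v = v ∈ˡ adj u

    m : ℕ
    m = sum (map (λ u → length (adj u)) (allFin n))

    Walk : Rel V _
    Walk = Star Edge

    vertices : ∀ {u v} → Walk u v → List V
    vertices {u} ε       = u ∷ []
    vertices {u} (e ◅ p) = u ∷ vertices p

    weight : ∀ {u v} → Walk u v → K
    weight     ε                 = 0#
    weight {u} (_◅_ {j = x} e p) = w u x +ᴷ weight p

    record Path (u v : V) : Set where
      field
        walk          : Walk u v
        non-repeating : Unique (vertices walk)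

    ∥_∥ : ∀ {u v} → Path u v → K
    ∥ p ∥ = weight (Path.walk p)

    -- IsDistance v x means δ(v) = x.
    data IsDistance (v : V) : K ⁺ → Set (c ⊔ ℓ₁ ⊔ ℓ₂) where
      finite   : ∀ {x} (p : Path s v) → ∥ p ∥ ≈ x → (∀ (q : Path s v) → x ≤ ∥ q ∥) →
                 IsDistance v [ x ]
      infinite : ¬ Path s v → IsDistance v ⊤⁺

    -- IsOptimum D means D = min { δ(t) | t ∈ T } (for D < ∞).
    record IsOptimum (D : K) : Set (c ⊔ ℓ₁ ⊔ ℓ₂) where
      field
        {target} : V
        target∈T : target ∈ T
        attained : IsDistance target [ D ]
        minimal  : ∀ {t x} → t ∈ T → IsDistance t x → [ D ] ≤⁺ x

    TargetReachable : Set
    TargetReachable = ∃ λ t → t ∈ T × Path s t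

  record Parameters : Set (c ⊔ ℓ₂) where
    field
      i₀           : ℕ
      α β          : K
      1≤α          : 1# ≤ α
      1<β          : 1# < β
      prediction   : List (K × K ⁺) → K
      prediction>0 : ∀ X → 0# < prediction X

-- Constant costs of the elementary operations: `initialise` per node,
-- `loop` per iteration (loop test, trace, evaluating the prediction),
-- `scan` per edge, `reserve` per insertion, key change or deletion in R,
-- `call` per nonempty bucket and `visit` per node of a processed bucket.
-- The remaining three are the Fibonacci heap constants: amortised
-- O(1) `insert` and `decrease`, and `delete` times 1 + log |PQ| for
-- removing a minimum.  As the heap is empty at first, amortised charges
-- bound the actual cost of an execution.

record UnitCosts : Set where
  field
    initialise loop scan reserve call visit insert decrease delete : ℕ

------------------------------------------------------------------------
-- The algorithm

module DijkstraPrediction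
  {c ℓ₁ ℓ₂} (F : ArchimedeanOrderedField c ℓ₁ ℓ₂)
  (costs : UnitCosts) (I : Instance F) (params : Parameters F) where

  open ArchimedeanOrderedField F
  open UnitCosts costs
  open Instance I
  open Parameters params

  -- The key of a node in PQ or R is its tentative distance d.
  record State : Set c where
    field
      d          : Vector (K ⁺) n
      B P        : K ⁺
      PQ R       : Subset n
      iterations : ℕ
      X          : List (K × K ⁺)
      time       : ℕ

  open State

  initial : State
  initial = record
    { d          = updateAt (const ⊤⁺) s (const [ 0# ])
    ; B          = ⊤⁺
    ; P          = ⊤⁺
    ; PQ         = ⁅ s ⁆
    ; R          = ⊥
    ; iterations = 0
    ; X          = []
    ; time       = initialise ℕ.* n ℕ.+ insert
    }

  charge : ℕ → State → State
  charge k σ = record σ { time = time σ ℕ.+ k }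

  place : V → K → State → State
  place v tent σ with d σ v
  ... | ⊤⁺ =
    if does ([ tent ] ≤⁺? P σ)
    then charge insert (record σ { PQ = PQ σ ∪ ⁅ v ⁆ })
    else charge reserve (record σ { R = R σ ∪ ⁅ v ⁆ })
  ... | [ _ ] =
    if does (v ∈? R σ)
    then (if does ([ tent ] ≤⁺? P σ)
          then charge (reserve ℕ.+ insert) (record σ { PQ = PQ σ ∪ ⁅ v ⁆ ; R = R σ - v })
          else charge reserve σ)
    else charge decrease σ

  setLabel : V → K → State → State
  setLabel v tent σ = record σ { d = updateAt (d σ) v (const [ tent ]) }

  relax : V → K → State → State
  relax v tent σ =
    if does (d σ v ≤⁺? [ tent ])
    then σ
    else setLabel v tent (place v tent σ)

  improveBound : V → K → State → State
  improveBound v tent σ =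
    if does (v ∈? T) then record σ { B = [ tent ] ⊓⁺ B σ } else σ

  scanEdge : V → K → State → State
  scanEdge v tent σ =
    charge scan
      (if does ([ tent ] ≤⁺? B σ) then relax v tent (improveBound v tent σ) else σ)

  scanEdges : V → K → State → State
  scanEdges u du σ = foldl (λ τ v → scanEdge v (du +ᴷ w u v) τ) σ (adj u)

  removeMin : V → State → State
  removeMin u σ =
    charge (loop ℕ.+ delete ℕ.* (1 ℕ.+ ⌈log₂ ∣ PQ σ ∣ ⌉))
      (record σ { PQ = PQ σ - u ; iterations = suc (iterations σ) })

  extendTrace : K → State → State
  extendTrace du σ =
    if does (iterations σ ℕ.≤? i₀) then record σ { X = X σ ++ (du , B σ) ∷ [] } else σ

  predict : State → State
  predict σ =
    if does (iterations σ ℕ.≟ i₀) then record σ { P = [ α *ᴷ prediction (X σ) ] } else σ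

  expand : V → K → State → State
  expand u du σ = scanEdges u du (predict (extendTrace du (removeMin u σ)))

  comprehension : ∀ {p} {Q : V → Set p} → (∀ v → Dec (Q v)) → Subset n
  comprehension Q? = Vec.tabulate λ v → does (Q? v)

  -- With P = β^(i-1) P₀ at the i-th call of Update-Prediction, bucket i
  -- consists of the nodes of R with key in (P , βP].
  bucket : State → Subset n
  bucket σ = comprehension λ v →
    v ∈? R σ ×-dec ¬? (d σ v ≤⁺? P σ) ×-dec d σ v ≤⁺? (β *⁺ P σ)

  released : State → Subset n
  released σ = comprehension λ v →
    v ∈? R σ ×-dec d σ v ≤⁺? (β *⁺ P σ) ×-dec d σ v ≤⁺? B σ

  -- Passing over an empty bucket is free: if the prediction is far too small,
  -- the number of empty buckets is not bounded in terms of n and m.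
  bucketCost : ℕ → ℕ
  bucketCost zero    = 0
  bucketCost (suc k) = call ℕ.+ visit ℕ.* suc k

  updatePrediction : State → State
  updatePrediction σ =
    charge (bucketCost ∣ bucket σ ∣ ℕ.+ insert ℕ.* ∣ released σ ∣)
      (record σ { P = β *⁺ P σ ; PQ = PQ σ ∪ released σ ; R = R σ ─ released σ })

  record IsMinimum (σ : State) (u : V) : Set (c ⊔ ℓ₂) where
    field
      queued : u ∈ PQ σ
      least  : ∀ {v} → v ∈ PQ σ → d σ u ≤⁺ d σ v

  -- PQ is empty or its minimum key exceeds P.
  LoopConditionFails : State → Set (c ⊔ ℓ₂)
  LoopConditionFails σ = ∀ {v} → v ∈ PQ σ → ¬ (d σ v ≤⁺ P σ)

  data Configuration : Set c where
    running : State → Configuration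
    stopped : V → State → Configuration

  elapsed : Configuration → ℕ
  elapsed (running σ)   = time σ
  elapsed (stopped _ σ) = time σ

  -- Ties between minimum keys are broken arbitrarily, so an instance has
  -- several executions in general.
  infix 4 _⟶_ _⟶*_
  data _⟶_ : Rel Configuration (c ⊔ ℓ₂) where
    stop    : ∀ {σ u} → IsMinimum σ u → d σ u ≤⁺ P σ → u ∈ T →
              running σ ⟶ stopped u (removeMin u σ)
    iterate : ∀ {σ u du} → IsMinimum σ u → d σ u ≤⁺ P σ → u ∉ T → d σ u ≡ [ du ] →
              running σ ⟶ running (expand u du σ)
    update  : ∀ {σ} → LoopConditionFails σ →
              running σ ⟶ running (updatePrediction σ)

  _⟶*_ : Rel Configuration (c ⊔ ℓ₂)
  _⟶*_ = Star _⟶_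

  start : Configuration
  start = running initial

  Terminates : Set (c ⊔ ℓ₂)
  Terminates =
    Acc (flip _⟶_) start ×
    (∀ {σ} → start ⟶* running σ → ∃ λ γ → running σ ⟶ γ)

  Tight : Vector (K ⁺) n → ∀ {u v} → Walk u v → Set (c ⊔ ℓ₁)
  Tight δ     ε                 = ⊤
  Tight δ {u} (_◅_ {j = x} e p) = δ x ≈⁺ (δ u +⁺ w u x) × Tight δ p

  -- The algorithm keeps no predecessors; `tight` lets a shortest path be read
  -- off from the labels.  Nodes v with δ(v) = D other than u may remain
  -- unlabelled because of ties, so `exact` cannot cover them.
  record Solves (D : K) (u : V) (σ : State) : Set (c ⊔ ℓ₁ ⊔ ℓ₂) where
    field
      u∈T      : u ∈ T
      du≈D     : d σ u ≈⁺ [ D ]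
      path     : Path s u
      ∥path∥≈D : ∥ path ∥ ≈ D
      tight    : Tight (d σ) (Path.walk path)
      exact    : ∀ {v x} → IsDistance v [ x ] → x < D → d σ v ≈⁺ [ x ]

  ComputesOptimum : Set (c ⊔ ℓ₁ ⊔ ℓ₂)
  ComputesOptimum =
    ∃ λ D → IsOptimum D × (∀ {u σ} → start ⟶* stopped u σ → Solves D u σ)

  -- Since each call multiplies P by β, this bounds the number of calls by
  -- 1 + log_β (D / P₀) if P₀ < D (and there is none otherwise), including the
  -- calls that pass over an empty bucket.
  UpdatesOnlyBelowOptimum : Set (c ⊔ ℓ₁ ⊔ ℓ₂)
  UpdatesOnlyBelowOptimum =
    ∀ {D σ} → IsOptimum D → start ⟶* running σ → LoopConditionFails σ → ¬ ([ D ] ≤⁺ P σ)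

  RunningTime≤ : ℕ → Set (c ⊔ ℓ₂)
  RunningTime≤ bound = ∀ {γ} → start ⟶* γ → elapsed γ ℕ.≤ bound

{-# OPTIONS --safe #-}

-- Call a node settled if it is labelled and neither in PQ nor in R.  Every
-- reserved node has d > P or d > B, and some target has d ≤ B; since targets are
-- never settled, a minimum of PQ with key at most P is a minimum of all unsettled
-- labels.  So the algorithm settles nodes in the order of Dijkstra's algorithm
-- whatever the prediction.  For a walk of length W from s to a target, either the
-- first unsettled node on it has label at most W, or an edge was pruned and some
-- target has d ≤ B < W.  Hence the target found is optimal, and P < W whenever the
-- loop condition fails, so that only finitely many calls of Update-Prediction
-- occur between two iterations.  For the running time, each node enters R and PQ
-- at most once, is removed at most once, and is visited in a bucket at most once:
-- it leaves the range d > P when its bucket is processed.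

module Submission where

open import Defs
open import Data.Nat.Base using (ℕ; _+_; _*_)
open import Data.Nat.Logarithm using (⌈log₂_⌉)
open import Data.Product.Base using (∃; _×_)

open import Algebra.Bundles using (CommutativeRing)
import Algebra.Construct.NaturalChoice.Min as Min
open import Data.Bool.Base using (true; false; if_then_else_)
open import Data.Empty using (⊥-elim)
open import Data.Fin.Base using (Fin; zero; suc)
open import Data.Fin.Properties using (_≟_; any?)
open import Data.Fin.Subset using (Subset; _∈_; _∉_; _∪_; _─_; _-_; ⁅_⁆; ∣_∣)
open import Data.Fin.Subset.Properties
  using (_∈?_; x∈p∪q⁻; x∈p∪q⁺; p─q⊆p; x∈p∧x∉q⇒x∈p─q; x∈p∧x≢y⇒x∈p-y; x∈⁅x⁆; x∈⁅y⁆⇒x≡y; ∉⊥; ∣p∣≤n)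
open import Data.List.Base using (List; []; _∷_; foldl; length; map; allFin; tabulate; filter)
open import Data.List.Membership.Propositional using () renaming (_∈_ to _∈ˡ_)
open import Data.List.Membership.Propositional.Properties using (∈-allFin; ∈-filter⁺)
open import Data.List.Properties using (map-tabulate; length-tabulate)
open import Data.List.Relation.Unary.All as All using (All; []; _∷_)
open import Data.List.Relation.Unary.All.Properties using (¬Any⇒All¬; all-filter)
open import Data.List.Relation.Unary.Any using (here; there)
open import Data.List.Relation.Unary.AllPairs using ([]; _∷_)
open import Data.List.Relation.Unary.Unique.Propositional using (Unique)
import Data.List.Extrema as Extrema
import Data.Nat as ℕ
import Data.Nat.Properties as ℕ
open import Data.Nat.ListAction using (sum)
open import Data.Nat.Logarithm using (⌈log₂⌉-mono-≤)
open import Data.Nat.Tactic.RingSolver using (solve-∀)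
open import Data.Product.Base using (_,_; proj₁; proj₂)
open import Data.Sum.Base using (_⊎_; inj₁; inj₂; [_,_]′)
import Data.Unit.Polymorphic.Base as Unit
import Data.Vec.Base as Vec
open import Data.Vec.Functional using (Vector)
open import Data.Vec.Functional.Properties using (updateAt-updates; updateAt-minimal)
open import Data.Vec.Properties using (lookup∘tabulate; []=⇒lookup; lookup⇒[]=)
open import Function.Base using (_∘_; const; flip; id)
open import Induction.WellFounded using (Acc; acc)
open import Level using (_⊔_)
open import Relation.Binary.Bundles using (DecTotalOrder)
open import Relation.Binary.Construct.Add.Point.Equality using (∙≈∙; [_]; [≈]-injective)
open import Relation.Binary.Construct.Add.Supremum.NonStrict using ([_]; _≤⊤⁺; [≤]-injective)
open import Relation.Binary.Construct.Closure.ReflexiveTransitive using (ε; _◅_)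
open import Relation.Binary.PropositionalEquality
  using (_≡_; _≢_; refl; sym; trans; cong; cong₂; subst)
open import Relation.Nullary using (¬_; Dec; yes; no; does; ¬?; _×-dec_; _⊎-dec_)
open import Relation.Nullary.Decidable using (dec-true)
open import Relation.Nullary.Construct.Add.Supremum using (_⁺; [_]; ⊤⁺)

-- The algorithm branches on `does`. With the motive `P` explicit, a test buried in a goal about
-- whole states can be split in place.
if-elim : ∀ {a b p} {A : Set a} {B : Set b} (P : B → Set p) (A? : Dec A) {x y : B} →
          (A → P x) → (¬ A → P y) → P (if does A? then x else y)
if-elim P (yes a) f g = f a
if-elim P (no ¬a) f g = g ¬a

-- Finite sums of natural numbers

∑ : ∀ {n} → (Fin n → ℕ) → ℕ
∑ {n} f = sum (map f (allFin n))

module _ {a} {A : Set a} where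

  sum-map-mono : ∀ {f g : A → ℕ} → (∀ x → f x ℕ.≤ g x) → ∀ xs → sum (map f xs) ℕ.≤ sum (map g xs)
  sum-map-mono f≤g []       = ℕ.z≤n
  sum-map-mono f≤g (x ∷ xs) = ℕ.+-mono-≤ (f≤g x) (sum-map-mono f≤g xs)

  sum-map-+ : ∀ (f g : A → ℕ) xs → sum (map (λ x → f x + g x) xs) ≡ sum (map f xs) + sum (map g xs)
  sum-map-+ f g []       = refl
  sum-map-+ f g (x ∷ xs) =
    trans (cong (f x + g x +_) (sum-map-+ f g xs))
          (interchange (f x) (g x) (sum (map f xs)) (sum (map g xs)))
    where
    interchange : ∀ a b c d → (a + b) + (c + d) ≡ (a + c) + (b + d)
    interchange = solve-∀

  sum-map-const : ∀ c (xs : List A) → sum (map (const c) xs) ≡ length xs * c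
  sum-map-const c []       = refl
  sum-map-const c (x ∷ xs) = cong (c +_) (sum-map-const c xs)

  sum-map-*ʳ : ∀ (f : A → ℕ) c xs → sum (map (λ x → f x * c) xs) ≡ sum (map f xs) * c
  sum-map-*ʳ f c []       = refl
  sum-map-*ʳ f c (x ∷ xs) =
    trans (cong (f x * c +_) (sum-map-*ʳ f c xs)) (sym (ℕ.*-distribʳ-+ c (f x) (sum (map f xs))))

  f≤sum-map : ∀ (f : A → ℕ) {x xs} → x ∈ˡ xs → f x ℕ.≤ sum (map f xs)
  f≤sum-map f (here refl)       = ℕ.m≤m+n _ _
  f≤sum-map f (there {x = y} p) = ℕ.≤-trans (f≤sum-map f p) (ℕ.m≤n+m _ (f y))

-- Masking by an indicator makes a sum over a decidable set a sum over all of `Fin n`, so that sums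
-- over different sets compare termwise.
when : ∀ {a} {A : Set a} → Dec A → ℕ → ℕ
when A? c = if does A? then c else 0

when-true : ∀ {a} {A : Set a} (A? : Dec A) {c} → A → when A? c ≡ c
when-true A? {c} a = if-elim (_≡ c) A? (λ _ → refl) (λ ¬a → ⊥-elim (¬a a))

when-split : ∀ {a b c} {A : Set a} {B : Set b} {C : Set c} (A? : Dec A) (B? : Dec B) (C? : Dec C) {k} →
             (A → C) → (B → C) → (A → ¬ B) → when A? k + when B? k ℕ.≤ when C? k
when-split (yes a) (yes b) C?      A→C B→C A→¬B = ⊥-elim (A→¬B a b)
when-split (yes a) (no _)  (yes _) A→C B→C A→¬B = ℕ.≤-reflexive (ℕ.+-identityʳ _)
when-split (yes a) (no _)  (no ¬c) A→C B→C A→¬B = ⊥-elim (¬c (A→C a))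
when-split (no _)  (yes b) (yes _) A→C B→C A→¬B = ℕ.≤-refl
when-split (no _)  (yes b) (no ¬c) A→C B→C A→¬B = ⊥-elim (¬c (B→C b))
when-split (no _)  (no _)  C?      A→C B→C A→¬B = ℕ.z≤n

when-≤ : ∀ {a} {A : Set a} (A? : Dec A) {c} → when A? c ℕ.≤ c
when-≤ A? {c} = if-elim (ℕ._≤ c) A? (λ _ → ℕ.≤-refl) (λ _ → ℕ.z≤n)

module _ {n a b c} {A : Fin n → Set a} {B : Fin n → Set b} {C : Fin n → Set c}
  (A? : ∀ i → Dec (A i)) (B? : ∀ i → Dec (B i)) (C? : ∀ i → Dec (C i)) (f : Fin n → ℕ) where

  -- Termwise, since no index lies in both `A` and `B`. With `B` the set of nodes charged in a step,
  -- it says that the potential falls by at least the charge.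
  ∑-when-split : (∀ {i} → A i → C i) → (∀ {i} → B i → C i) → (∀ {i} → A i → ¬ B i) →
                 ∑ (λ i → when (A? i) (f i)) + ∑ (λ i → when (B? i) (f i)) ℕ.≤
                 ∑ (λ i → when (C? i) (f i))
  ∑-when-split A→C B→C A→¬B =
    ℕ.≤-trans (ℕ.≤-reflexive (sym (sum-map-+ (λ i → when (A? i) (f i)) _ (allFin n))))
              (sum-map-mono (λ i → when-split (A? i) (B? i) (C? i) A→C B→C A→¬B) (allFin n))

module _ {n a c} {A : Fin n → Set a} {C : Fin n → Set c}
  (A? : ∀ i → Dec (A i)) (C? : ∀ i → Dec (C i)) (f : Fin n → ℕ) where

  ∑-when-mono : (∀ {i} → A i → C i) → ∑ (λ i → when (A? i) (f i)) ℕ.≤ ∑ (λ i → when (C? i) (f i))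
  ∑-when-mono A→C = ℕ.≤-trans (ℕ.m≤m+n _ _)
    -- The second set is empty.
    (∑-when-split A? (λ _ → no id) C? f A→C ⊥-elim (λ _ → id))

  ∑-when-remove : ∀ u → (∀ {i} → A i → C i) → C u → ¬ A u →
                  ∑ (λ i → when (A? i) (f i)) + f u ℕ.≤ ∑ (λ i → when (C? i) (f i))
  ∑-when-remove u A→C Cu ¬Au = ℕ.≤-trans
    (ℕ.+-monoʳ-≤ (∑ (λ i → when (A? i) (f i)))
      (ℕ.≤-trans (ℕ.≤-reflexive (sym (when-true (u ≟ u) refl)))
                 (f≤sum-map (λ i → when (i ≟ u) (f i)) (∈-allFin u))))
    -- The second set is the singleton of `u`.
    (∑-when-split A? (_≟ u) C? f A→C (λ { refl → Cu }) (λ { Ai refl → ¬Au Ai }))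

∑-when-≤ : ∀ {n a} {A : Fin n → Set a} (A? : ∀ i → Dec (A i)) (f : Fin n → ℕ) →
           ∑ (λ i → when (A? i) (f i)) ℕ.≤ ∑ f
∑-when-≤ {n} A? f = sum-map-mono (λ i → when-≤ (A? i)) (allFin n)

∑-const : ∀ n c → ∑ {n} (const c) ≡ n * c
∑-const n c = trans (sum-map-const c (allFin n)) (cong (_* c) (length-tabulate {n = n} id))

-- The right-hand side is the form in which `updatePrediction` charges for the nodes of a
-- `comprehension`.
∑-when-const : ∀ {n a} {A : Fin n → Set a} (A? : ∀ i → Dec (A i)) c →
               ∑ (λ i → when (A? i) c) ≡ c * ∣ Vec.tabulate (does ∘ A?) ∣
∑-when-const {n} A? c = trans (cong sum (map-tabulate {n = n} id (λ i → when (A? i) c))) (go A?)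
  where
  go : ∀ {n a} {A : Fin n → Set a} (A? : ∀ i → Dec (A i)) →
       sum (tabulate (λ i → when (A? i) c)) ≡ c * ∣ Vec.tabulate (does ∘ A?) ∣
  go {ℕ.zero}  A? = sym (ℕ.*-zeroʳ c)
  go {ℕ.suc n} A? with A? zero
  ... | yes _ = trans (cong (c +_) (go (A? ∘ suc))) (sym (ℕ.*-suc c _))
  ... | no  _ = go (A? ∘ suc)

-- Subsets cut out by decidable predicates

module _ {n a} {A : Fin n → Set a} (A? : ∀ i → Dec (A i)) where

  ∈-tabulate⁺ : ∀ {i} → A i → i ∈ Vec.tabulate (does ∘ A?)
  ∈-tabulate⁺ {i} Ai = lookup⇒[]= i _
    (trans (lookup∘tabulate (does ∘ A?) i) (dec-true (A? i) Ai))

  ∈-tabulate⁻ : ∀ {i} → i ∈ Vec.tabulate (does ∘ A?) → A i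
  ∈-tabulate⁻ {i} i∈ with A? i | trans (sym (lookup∘tabulate (does ∘ A?) i)) ([]=⇒lookup i∈)
  ... | yes Ai | _ = Ai
  ... | no  _  | ()

p─q⇒∉q : ∀ {n} (p q : Subset n) {x} → x ∈ p ─ q → x ∉ q
p─q⇒∉q (_ Vec.∷ p) (_ Vec.∷ q) (Vec.there x∈) (Vec.there x∈q) = p─q⇒∉q p q x∈ x∈q
p─q⇒∉q (true Vec.∷ p) (.true Vec.∷ q) () Vec.here
p─q⇒∉q (false Vec.∷ p) (.true Vec.∷ q) () Vec.here

-- Ordered fields and their extension by infinity

module OrderedField {c ℓ₁ ℓ₂} (F : ArchimedeanOrderedField c ℓ₁ ℓ₂) where

  open ArchimedeanOrderedField F public
  open CommutativeRing commutativeRing public using (-_)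

  order : DecTotalOrder c ℓ₁ ℓ₂
  order = record { isDecTotalOrder = isDecTotalOrder }

  module K = CommutativeRing commutativeRing
  module ≤ᴷ = DecTotalOrder order
  module ≤⁺ = DecTotalOrder extendedOrder
  module ⊓⁺ = Min ≤⁺.totalOrder
  open import Relation.Binary.Reasoning.Setoid K.setoid

  infix 4 _<⁺_
  _<⁺_ : K ⁺ → K ⁺ → Set (c ⊔ ℓ₂)
  x <⁺ y = ¬ (y ≤⁺ x)

  <⁺⇒≤⁺ : ∀ {x y} → x <⁺ y → x ≤⁺ y
  <⁺⇒≤⁺ {x} {y} x<y with ≤⁺.total x y
  ... | inj₁ x≤y = x≤y
  ... | inj₂ y≤x = ⊥-elim (x<y y≤x)

  <⁺-≤⁺-trans : ∀ {x y z} → x <⁺ y → y ≤⁺ z → x <⁺ z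
  <⁺-≤⁺-trans x<y y≤z z≤x = x<y (≤⁺.trans y≤z z≤x)

  ≤⁺-<⁺-trans : ∀ {x y z} → x ≤⁺ y → y <⁺ z → x <⁺ z
  ≤⁺-<⁺-trans x≤y y<z z≤x = y<z (≤⁺.trans z≤x x≤y)

  ≡⇒≤⁺ : ∀ {x y} → x ≡ y → x ≤⁺ y
  ≡⇒≤⁺ refl = ≤⁺.refl

  ⊤⁺? : ∀ (x : K ⁺) → Dec (x ≡ ⊤⁺)
  ⊤⁺? [ _ ] = no λ ()
  ⊤⁺? ⊤⁺    = yes refl

  ≤⁺-labelled : ∀ {x y} → x ≤⁺ y → y ≢ ⊤⁺ → x ≢ ⊤⁺
  ≤⁺-labelled (_ ≤⊤⁺) y≢⊤ _ = y≢⊤ refl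
  ≤⁺-labelled [ _ ]   _   ()

  finite-value : ∀ {x : K ⁺} → x ≢ ⊤⁺ → ∃ λ k → x ≡ [ k ]
  finite-value {[ k ]} _   = k , refl
  finite-value {⊤⁺}    x≢⊤ = ⊥-elim (x≢⊤ refl)

  +-monoʳ-≤ : ∀ z {x y} → x ≤ y → z +ᴷ x ≤ z +ᴷ y
  +-monoʳ-≤ z {x} {y} x≤y =
    ≤ᴷ.trans (≤ᴷ.reflexive (K.+-comm z x)) (≤ᴷ.trans (+-mono-≤ z x≤y) (≤ᴷ.reflexive (K.+-comm y z)))

  x≤x+y : ∀ {x y} → 0# ≤ y → x ≤ x +ᴷ y
  x≤x+y {x} 0≤y = ≤ᴷ.trans (≤ᴷ.reflexive (K.sym (K.+-identityʳ x))) (+-monoʳ-≤ x 0≤y)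

  +-nonneg : ∀ {x y} → 0# ≤ x → 0# ≤ y → 0# ≤ x +ᴷ y
  +-nonneg 0≤x 0≤y = ≤ᴷ.trans 0≤x (x≤x+y 0≤y)

  +⁺-monoˡ-≤ : ∀ {x y} z → x ≤⁺ y → x +⁺ z ≤⁺ y +⁺ z
  +⁺-monoˡ-≤ z [ x≤y ]  = [ +-mono-≤ z x≤y ]
  +⁺-monoˡ-≤ z (_ ≤⊤⁺) = _ ≤⊤⁺

  +⁺-congʳ : ∀ {x y} z → x ≈⁺ y → x +⁺ z ≈⁺ y +⁺ z
  +⁺-congʳ z ∙≈∙     = ∙≈∙
  +⁺-congʳ z [ x≈y ] = [ K.+-congʳ x≈y ]

  ≤-difference : ∀ {x y} → x ≤ y → 0# ≤ y +ᴷ - x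
  ≤-difference {x} x≤y = ≤ᴷ.trans (≤ᴷ.reflexive (K.sym (K.-‿inverseʳ x))) (+-mono-≤ (- x) x≤y)

  -- Growth rate of multiplication by `x`: passing from `y` to `x *ᴷ y` adds `excess x *ᴷ y`. For
  -- `x = β` it measures the progress of an update.
  excess : K → K
  excess x = x +ᴷ - 1#

  excess-* : ∀ x y → y +ᴷ excess x *ᴷ y ≈ x *ᴷ y
  excess-* x y = begin
    y +ᴷ excess x *ᴷ y              ≈⟨ K.+-congʳ (K.*-identityˡ y) ⟨
    1# *ᴷ y +ᴷ excess x *ᴷ y        ≈⟨ K.distribʳ y 1# (excess x) ⟨
    (1# +ᴷ excess x) *ᴷ y           ≈⟨ K.*-congʳ (begin
      1# +ᴷ (x +ᴷ - 1#)               ≈⟨ K.+-comm _ _ ⟩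
      x +ᴷ - 1# +ᴷ 1#                 ≈⟨ K.+-assoc _ _ _ ⟩
      x +ᴷ (- 1# +ᴷ 1#)               ≈⟨ K.+-congˡ (K.-‿inverseˡ 1#) ⟩
      x +ᴷ 0#                         ≈⟨ K.+-identityʳ x ⟩
      x                               ∎) ⟩
    x *ᴷ y                          ∎

  <⇒≤ : ∀ {x y} → x < y → x ≤ y
  <⇒≤ {x} {y} x<y with ≤ᴷ.total x y
  ... | inj₁ x≤y = x≤y
  ... | inj₂ y≤x = ⊥-elim (x<y y≤x)

  -- The order axioms for products speak only of nonnegative factors, so `x *ᴷ y` is written as `y`
  -- plus the nonnegative `excess x *ᴷ y`.
  scale-≤ : ∀ {x y} → 1# ≤ x → 0# ≤ y → y ≤ x *ᴷ y
  scale-≤ {x} {y} 1≤x 0≤y =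
    ≤ᴷ.trans (x≤x+y (*-nonneg (≤-difference 1≤x) 0≤y)) (≤ᴷ.reflexive (excess-* x y))

  excess-pos : ∀ {x} → 1# < x → 0# < excess x
  excess-pos {x} 1<x ε≤0 = 1<x (≤ᴷ.trans (≤ᴷ.reflexive x≈) (≤ᴷ.trans (+-monoʳ-≤ 1# ε≤0) (≤ᴷ.reflexive (K.+-identityʳ 1#))))
    where
    x≈ : x ≈ 1# +ᴷ excess x
    x≈ = begin
      x                        ≈⟨ K.*-identityʳ x ⟨
      x *ᴷ 1#                  ≈⟨ excess-* x 1# ⟨
      1# +ᴷ excess x *ᴷ 1#     ≈⟨ K.+-congˡ (K.*-identityʳ _) ⟩
      1# +ᴷ excess x           ∎

  -- If the product were at most zero, it would equal zero, and multiplying by the inverse of `y`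
  -- would make `x` zero.
  *-pos : ∀ {x y} → 0# < x → 0# < y → 0# < x *ᴷ y
  *-pos {x} {y} 0<x 0<y xy≤0 = 0<x (≤ᴷ.reflexive (begin
    x                 ≈⟨ K.*-identityʳ x ⟨
    x *ᴷ 1#           ≈⟨ K.*-congˡ (proj₂ y⁻¹) ⟨
    x *ᴷ (y *ᴷ z)     ≈⟨ K.*-assoc x y z ⟨
    x *ᴷ y *ᴷ z       ≈⟨ K.*-congʳ (≤ᴷ.antisym xy≤0 (*-nonneg (<⇒≤ 0<x) (<⇒≤ 0<y))) ⟩
    0# *ᴷ z           ≈⟨ K.zeroˡ z ⟩
    0#                ∎))
    where
    y⁻¹ = inverse (λ y≈0 → 0<y (≤ᴷ.reflexive y≈0))
    z = proj₁ y⁻¹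

  scale-≤⁺ : ∀ {x y} → 1# ≤ x → [ 0# ] ≤⁺ y → y ≤⁺ x *⁺ y
  scale-≤⁺ 1≤x [ 0≤y ]   = [ scale-≤ 1≤x 0≤y ]
  scale-≤⁺ 1≤x (_ ≤⊤⁺) = ⊤⁺ ≤⊤⁺

  ⊓⁺-sel : ∀ x y → (x ⊓⁺ y ≡ x) ⊎ (x ⊓⁺ y ≡ y)
  ⊓⁺-sel x y with ≤⁺.total x y
  ... | inj₁ _ = inj₁ refl
  ... | inj₂ _ = inj₂ refl

-- Absorbs the terms linear in the number of nodes into the bound. The `1 +` serves the case of one
-- node, where the logarithm vanishes.
n≤1+n⌈log₂n⌉ : ∀ k → k ℕ.≤ 1 + k * ⌈log₂ k ⌉
n≤1+n⌈log₂n⌉ 0 = ℕ.z≤n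
n≤1+n⌈log₂n⌉ 1 = ℕ.≤-refl
n≤1+n⌈log₂n⌉ k@(ℕ.suc (ℕ.suc _)) = ℕ.m≤n⇒m≤1+n (ℕ.≤-trans (ℕ.≤-reflexive (sym (ℕ.*-identityʳ k)))
  (ℕ.*-monoʳ-≤ k (⌈log₂⌉-mono-≤ {2} {k} (ℕ.s≤s (ℕ.s≤s ℕ.z≤n)))))

-- Constants of the running time

module Costs (costs : UnitCosts) where

  open UnitCosts costs public

  placeCost edgeCost visitCost runningConstant : ℕ
  placeCost       = insert + reserve + decrease
  edgeCost        = scan + placeCost
  visitCost       = call + visit
  runningConstant = initialise + insert + (loop + delete + insert + visitCost) + delete + edgeCost

module Correctness {c ℓ₁ ℓ₂} (costs : UnitCosts) (F : ArchimedeanOrderedField c ℓ₁ ℓ₂)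
  (I : Instance F) (params : Parameters F) where

  open OrderedField F
  open Costs costs
  open Instance I
  open Parameters params
  open DijkstraPrediction F costs I params
  open State
  open import Data.List.Membership.DecPropositional (_≟_ {n}) using () renaming (_∈?_ to _∈ˡ?_)

  -- Walks

  weight≥0 : ∀ {u v} (p : Walk u v) → 0# ≤ weight p
  weight≥0 ε       = ≤ᴷ.refl
  weight≥0 (e ◅ p) = +-nonneg (w≥0 e) (weight≥0 p)

  suffix : ∀ δ {u v x} (p : Walk u v) → Unique (vertices p) → Tight δ p → x ∈ˡ vertices p →
           ∃ λ (q : Path x v) → Tight δ (Path.walk q)
  suffix δ ε       uniq       tight       (here refl) = record { walk = ε ; non-repeating = uniq } , tight
  suffix δ (e ◅ p) uniq       tight       (here refl) = record { walk = e ◅ p ; non-repeating = uniq } , tight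
  suffix δ (e ◅ p) (_ ∷ uniq) (_ , tight) (there x∈p) = suffix δ p uniq tight x∈p

  -- If `u` recurs on the path found for the rest, the suffix from that occurrence replaces the
  -- walk. Tightness survives because it is a condition on single edges.
  shortcut : ∀ δ {u v} (p : Walk u v) → Tight δ p → ∃ λ (q : Path u v) → Tight δ (Path.walk q)
  shortcut δ ε tight = record { walk = ε ; non-repeating = [] ∷ [] } , tight
  shortcut δ {u} (e ◅ p) (t , tight)
    with shortcut δ p tight
  ... | record { walk = q ; non-repeating = uniq } , tight′ with u ∈ˡ? vertices q
  ...   | yes u∈q = suffix δ q uniq tight′ u∈q
  ...   | no  u∉q = record { walk = e ◅ q ; non-repeating = ¬Any⇒All¬ _ u∉q ∷ uniq } , (t , tight′)

  -- The labels telescope along tight edges.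
  tight-weight : ∀ δ {u v a} (p : Walk u v) → Tight δ p → δ u ≈⁺ [ a ] → δ v ≈⁺ [ a +ᴷ weight p ]
  tight-weight δ ε _ δu≈a = ≤⁺.Eq.trans δu≈a [ K.sym (K.+-identityʳ _) ]
  tight-weight δ (e ◅ p) (t , tight) δu≈a =
    ≤⁺.Eq.trans (tight-weight δ p tight (≤⁺.Eq.trans t (+⁺-congʳ _ δu≈a))) [ K.+-assoc _ _ _ ]

  -- With S = Settled, all nodes but the last have their final label, so that
  -- relaxing another node cannot invalidate the certificate.
  data Reached (δ : Vector (K ⁺) n) (S : V → Set c) : V → Set (c ⊔ ℓ₁) where
    root  : δ s ≈⁺ [ 0# ] → Reached δ S s
    child : ∀ {u v} → Reached δ S u → S u → Edge u v → δ v ≈⁺ δ u +⁺ w u v → Reached δ S v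

  -- A certificate reads labels only at settled nodes and at its end, so other labels may change
  -- freely while more nodes become settled.
  Reached-map : ∀ {δ δ′ S S′} → (∀ {x} → S x → S′ x) → (∀ {x} → S x → δ′ x ≡ δ x) →
                ∀ {v} → δ′ v ≡ δ v → Reached δ S v → Reached δ′ S′ v
  Reached-map S⊆ δ≡ v≡ (root s≈0) = root (subst (_≈⁺ _) (sym v≡) s≈0)
  Reached-map S⊆ δ≡ v≡ (child {u} r Su e v≈) =
    child (Reached-map S⊆ δ≡ (δ≡ Su) r) (S⊆ Su) e
          (subst (λ x → x ≈⁺ _) (sym v≡) (subst (λ x → _ ≈⁺ x +⁺ _) (sym (δ≡ Su)) v≈))

  -- Certificates grow at the end and walks at the front, so `q` accumulates the part already
  -- traversed on the way back to `s`.
  tight-walk : ∀ {δ S u v} → Reached δ S u → (q : Walk u v) → Tight δ q →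
               δ s ≈⁺ [ 0# ] × ∃ λ (p : Walk s v) → Tight δ p
  tight-walk (root s≈0)       q tight = s≈0 , q , tight
  tight-walk (child r _ e t) q tight = tight-walk r (e ◅ q) (t , tight)

  tight-path : ∀ {δ S v} → Reached δ S v → ∃ λ (p : Path s v) → Tight δ (Path.walk p) × δ v ≈⁺ [ ∥ p ∥ ]
  tight-path {δ} r with tight-walk r ε Unit.tt
  ... | s≈0 , p , tight with shortcut δ p tight
  ...   | q , tight′ = q , tight′ , ≤⁺.Eq.trans (tight-weight δ (Path.walk q) tight′ s≈0) [ K.+-identityˡ _ ]

  -- The loop invariant

  Unsettled Settled : State → V → Set c
  Unsettled σ v = d σ v ≡ ⊤⁺ ⊎ v ∈ PQ σ ⊎ v ∈ R σ
  Settled   σ v = ¬ Unsettled σ v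

  unsettled? : ∀ σ v → Dec (Unsettled σ v)
  unsettled? σ v = ⊤⁺? (d σ v) ⊎-dec (v ∈? PQ σ) ⊎-dec (v ∈? R σ)

  settled⇒labelled : ∀ {σ v} → Settled σ v → d σ v ≢ ⊤⁺
  settled⇒labelled = _∘ inj₁

  -- While the out-edges of u are scanned, `rem` lists the heads still to come;
  -- otherwise `rem` is empty and u is arbitrary.
  record Core (u : V) (rem : List V) (σ : State) : Set (c ⊔ ℓ₁ ⊔ ℓ₂) where
    field
      source         : d σ s ≤⁺ [ 0# ]
      PQ-labelled    : ∀ {v} → v ∈ PQ σ → d σ v ≢ ⊤⁺
      R-labelled     : ∀ {v} → v ∈ R σ → d σ v ≢ ⊤⁺
      disjoint       : ∀ {v} → v ∈ PQ σ → v ∉ R σ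
      reached        : ∀ {v} → d σ v ≢ ⊤⁺ → Reached (d σ) (Settled σ) v
      settled≤       : ∀ {x y} → Settled σ x → Unsettled σ y → d σ x ≤⁺ d σ y
      target         : ∀ {t} → t ∈ T → Unsettled σ t
      reserved       : ∀ {v} → v ∈ R σ → P σ <⁺ d σ v ⊎ B σ <⁺ d σ v
      reserve-finite : ∀ {v} → v ∈ R σ → P σ ≢ ⊤⁺
      relaxed        : ∀ {x y} → Settled σ x → Edge x y →
                       (x ≡ u × y ∈ˡ rem) ⊎ (B σ <⁺ d σ x +⁺ w x y) ⊎ (d σ y ≤⁺ d σ x +⁺ w x y)
      P>0            : [ 0# ] <⁺ P σ
      early          : iterations σ ℕ.< i₀ → P σ ≡ ⊤⁺

  -- A finite `B` was once offered to some target as tentative distance, and that target's label has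
  -- not risen since. While `B` is infinite, any target serves.
  Bounded : State → Set (c ⊔ ℓ₂)
  Bounded σ = ∃ λ t → t ∈ T × d σ t ≤⁺ B σ

  record Scanning (u : V) (du : K) (σ : State) : Set (c ⊔ ℓ₂) where
    field
      label   : d σ u ≡ [ du ]
      settled : Settled σ u
      latest  : ∀ {x} → Settled σ x → d σ x ≤⁺ [ du ]

  -- Following walks to unsettled nodes, and optimality

  module _ {u σ} (core : Core u [] σ) (bounded : Bounded σ) where

    open Core core

    -- Induction on the walk, up to the first unsettled node. A pruned edge ends the search too: the
    -- target with label at most `B` is unsettled, and `B` is below the length walked so far.
    follow : ∀ {x v a} (p : Walk x v) → d σ x ≤⁺ [ a ] →
             (Settled σ v × d σ v ≤⁺ [ a +ᴷ weight p ]) ⊎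
             (∃ λ y → Unsettled σ y × d σ y ≤⁺ [ a +ᴷ weight p ])
    follow {x} {a = a} p dx≤a with unsettled? σ x
    follow {x} {a = a} p dx≤a | yes ux =
      inj₂ (x , ux , ≤⁺.trans dx≤a [ x≤x+y (weight≥0 p) ])
    follow {x} {a = a} ε dx≤a | no sx =
      inj₁ (sx , ≤⁺.trans dx≤a [ x≤x+y ≤ᴷ.refl ])
    follow {x} {a = a} (_◅_ {j = y} e p) dx≤a | no sx with relaxed sx e
    ... | inj₁ (_ , ())
    ... | inj₂ (inj₁ B<) = inj₂ (t , target t∈T , ≤⁺.trans dt≤B (≤⁺.trans (<⁺⇒≤⁺ B<)
            (≤⁺.trans (+⁺-monoˡ-≤ _ dx≤a) [ +-monoʳ-≤ a (x≤x+y (weight≥0 p)) ])))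
      where
      t = proj₁ bounded
      t∈T = proj₁ (proj₂ bounded)
      dt≤B = proj₂ (proj₂ bounded)
    ... | inj₂ (inj₂ dy≤) with follow p (≤⁺.trans dy≤ (+⁺-monoˡ-≤ _ dx≤a))
    ...   | inj₁ (sv , dv≤)     = inj₁ (sv , ≤⁺.trans dv≤ [ ≤ᴷ.reflexive (K.+-assoc _ _ _) ])
    ...   | inj₂ (z , uz , dz≤) = inj₂ (z , uz , ≤⁺.trans dz≤ [ ≤ᴷ.reflexive (K.+-assoc _ _ _) ])

    follow-target : ∀ {t} → t ∈ T → (p : Walk s t) → ∃ λ y → Unsettled σ y × d σ y ≤⁺ [ weight p ]
    follow-target t∈T p with follow p source
    ... | inj₁ (st , _)       = ⊥-elim (st (target t∈T))
    ... | inj₂ (y , uy , dy≤) = y , uy , ≤⁺.trans dy≤ [ ≤ᴷ.reflexive (K.+-identityˡ _) ]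

    -- A reserved node with d ≤ P has d > B, so it is dominated by a target with d ≤ B.
    frontier : ∀ {y} → Unsettled σ y →
               ∃ λ z → d σ z ≤⁺ d σ y × (d σ z ≡ ⊤⁺ ⊎ z ∈ PQ σ ⊎ P σ <⁺ d σ z)
    frontier {y} (inj₁ y≡⊤)         = y , ≤⁺.refl , inj₁ y≡⊤
    frontier {y} (inj₂ (inj₁ y∈PQ)) = y , ≤⁺.refl , inj₂ (inj₁ y∈PQ)
    frontier {y} (inj₂ (inj₂ y∈R)) with reserved y∈R
    ... | inj₁ P<dy = y , ≤⁺.refl , inj₂ (inj₂ P<dy)
    ... | inj₂ B<dy = t , ≤⁺.trans dt≤B (<⁺⇒≤⁺ B<dy) , t-status
      where
      t = proj₁ bounded
      dt≤B = proj₂ (proj₂ bounded)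
      t-status : d σ t ≡ ⊤⁺ ⊎ t ∈ PQ σ ⊎ P σ <⁺ d σ t
      t-status with target (proj₁ (proj₂ bounded))
      ... | inj₁ t≡⊤         = inj₁ t≡⊤
      ... | inj₂ (inj₁ t∈PQ) = inj₂ (inj₁ t∈PQ)
      ... | inj₂ (inj₂ t∈R) with reserved t∈R
      ...   | inj₁ P<dt = inj₂ (inj₂ P<dt)
      ...   | inj₂ B<dt = ⊥-elim (B<dt dt≤B)

    -- By `frontier`, every unsettled label dominates one that is infinite, queued or above `P`, and
    -- the minimum is at most each of these.
    minimum≤unsettled : ∀ {v y} → IsMinimum σ v → d σ v ≤⁺ P σ → Unsettled σ y → d σ v ≤⁺ d σ y
    minimum≤unsettled {v} min dv≤P uy with frontier uy
    ... | z , dz≤dy , inj₁ z≡⊤         = ≤⁺.trans (subst (d σ v ≤⁺_) (sym z≡⊤) (_ ≤⊤⁺)) dz≤dy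
    ... | z , dz≤dy , inj₂ (inj₁ z∈PQ) = ≤⁺.trans (IsMinimum.least min z∈PQ) dz≤dy
    ... | z , dz≤dy , inj₂ (inj₂ P<dz) = ≤⁺.trans dv≤P (≤⁺.trans (<⁺⇒≤⁺ P<dz) dz≤dy)

    P<unsettled : ∀ {y} → LoopConditionFails σ → Unsettled σ y → d σ y ≢ ⊤⁺ → P σ <⁺ d σ y
    P<unsettled fails uy y≢⊤ with frontier uy
    ... | z , dz≤dy , inj₁ z≡⊤         = ⊥-elim (≤⁺-labelled dz≤dy y≢⊤ z≡⊤)
    ... | z , dz≤dy , inj₂ (inj₁ z∈PQ) = <⁺-≤⁺-trans (fails z∈PQ) dz≤dy
    ... | z , dz≤dy , inj₂ (inj₂ P<dz) = <⁺-≤⁺-trans P<dz dz≤dy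

    -- Used twice: it bounds the number of consecutive updates in the termination proof, and it
    -- confines updates to predictions below the optimum.
    P<target-walk : ∀ {t} → LoopConditionFails σ → t ∈ T → (p : Walk s t) → P σ <⁺ [ weight p ]
    P<target-walk fails t∈T p with follow-target t∈T p
    ... | y , uy , dy≤ = <⁺-≤⁺-trans (P<unsettled fails uy (≤⁺-labelled dy≤ λ ())) dy≤

    module _ {v D} (min : IsMinimum σ v) (dv≤P : d σ v ≤⁺ P σ) (v∈T : v ∈ T) (dv≈D : d σ v ≈⁺ [ D ]) where

      D≤unsettled : ∀ {y} → Unsettled σ y → [ D ] ≤⁺ d σ y
      D≤unsettled uy = ≤⁺.trans (≤⁺.reflexive (≤⁺.Eq.sym dv≈D)) (minimum≤unsettled min dv≤P uy)

      D≤target-walk : ∀ {t} → t ∈ T → (p : Walk s t) → D ≤ weight p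
      D≤target-walk t∈T p with follow-target t∈T p
      ... | y , uy , dy≤ = [≤]-injective _≤_ (≤⁺.trans (D≤unsettled uy) dy≤)

      shortest : ∃ λ (p : Path s v) → Tight (d σ) (Path.walk p) × ∥ p ∥ ≈ D
      shortest with tight-path (reached (PQ-labelled (IsMinimum.queued min)))
      ... | p , tight , dv≈p = p , tight , [≈]-injective _≈_ (≤⁺.Eq.trans (≤⁺.Eq.sym dv≈p) dv≈D)

      optimum : IsOptimum D
      optimum = record
        { target∈T = v∈T
        ; attained = finite (proj₁ shortest) (proj₂ (proj₂ shortest)) (λ q → D≤target-walk v∈T (Path.walk q))
        ; minimal  = λ
          { t∈T (finite p p≈x _) → [ ≤ᴷ.trans (D≤target-walk t∈T (Path.walk p)) (≤ᴷ.reflexive p≈x) ]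
          ; t∈T (infinite _)     → _ ≤⊤⁺
          }
        }

      -- An unsettled node met along the shortest path would have label at most `x`, which is less
      -- than `D`. So `y` is settled with label at most `x`, and no label is below the distance
      -- since each is the length of a path.
      settled-below-D : ∀ {y x} → IsDistance y [ x ] → x < D → d σ y ≈⁺ [ x ]
      settled-below-D {y} {x} (finite p p≈x x≤) x<D with follow (Path.walk p) source
      ... | inj₂ (z , uz , dz≤) = ⊥-elim (x<D ([≤]-injective _≤_ (≤⁺.trans (D≤unsettled uz)
              (≤⁺.trans dz≤ [ ≤ᴷ.reflexive (K.trans (K.+-identityˡ _) p≈x) ]))))
      ... | inj₁ (sy , dy≤) with tight-path (reached (settled⇒labelled {σ} sy))
      ...   | q , _ , dy≈q = ≤⁺.antisym
              (≤⁺.trans dy≤ [ ≤ᴷ.reflexive (K.trans (K.+-identityˡ _) p≈x) ])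
              (≤⁺.trans [ x≤ q ] (≤⁺.reflexive (≤⁺.Eq.sym dy≈q)))

      solves : Solves D v (removeMin v σ)
      solves = record
        { u∈T      = v∈T
        ; du≈D     = dv≈D
        ; path     = proj₁ shortest
        ; ∥path∥≈D = proj₂ (proj₂ shortest)
        ; tight    = proj₁ (proj₂ shortest)
        ; exact    = settled-below-D
        }

  -- Amortised cost

  Pending : State → V → Set c
  Pending σ v = d σ v ≡ ⊤⁺ ⊎ v ∈ R σ

  -- Nodes that may still be visited in a bucket.
  Fresh : State → V → Set (c ⊔ ℓ₂)
  Fresh σ v = d σ v ≡ ⊤⁺ ⊎ (v ∈ R σ × P σ <⁺ d σ v)

  pending? : ∀ σ v → Dec (Pending σ v)
  pending? σ v = ⊤⁺? (d σ v) ⊎-dec (v ∈? R σ)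

  fresh? : ∀ σ v → Dec (Fresh σ v)
  fresh? σ v = ⊤⁺? (d σ v) ⊎-dec ((v ∈? R σ) ×-dec ¬? (d σ v ≤⁺? P σ))

  removalCost : ℕ
  removalCost = loop + delete * (1 + ⌈log₂ n ⌉)

  nodeCost : V → ℕ
  nodeCost v = removalCost + length (adj v) * edgeCost

  -- The cost still to be charged: removing and expanding each unsettled node,
  -- moving each pending node into PQ, and visiting each fresh node once.
  Φ₁ Φ₂ Φ₃ Φ : State → ℕ
  Φ₁ σ = ∑ λ v → when (unsettled? σ v) (nodeCost v)
  Φ₂ σ = ∑ λ v → when (pending? σ v) insert
  Φ₃ σ = ∑ λ v → when (fresh? σ v) visitCost
  Φ  σ = Φ₁ σ + (Φ₂ σ + Φ₃ σ)

  Φ₂₃-mono : ∀ {σ τ} → (∀ {v} → Pending τ v → Pending σ v) → (∀ {v} → Fresh τ v → Fresh σ v) →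
             Φ₂ τ + Φ₃ τ ℕ.≤ Φ₂ σ + Φ₃ σ
  Φ₂₃-mono {σ} {τ} pend fresh = ℕ.+-mono-≤
    (∑-when-mono (pending? τ) (pending? σ) (const insert) pend)
    (∑-when-mono (fresh? τ) (fresh? σ) (const visitCost) fresh)

  Φ-mono : ∀ {σ τ} → (∀ {v} → Unsettled τ v → Unsettled σ v) → (∀ {v} → Pending τ v → Pending σ v) →
           (∀ {v} → Fresh τ v → Fresh σ v) → Φ τ ℕ.≤ Φ σ
  Φ-mono {σ} {τ} uns pend fresh = ℕ.+-mono-≤
    (∑-when-mono (unsettled? τ) (unsettled? σ) nodeCost uns) (Φ₂₃-mono {σ} {τ} pend fresh)

  -- Scanning an edge

  -- Common shape of the branches of `place`: membership changes for `v` only, which ends in exactly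
  -- one of the two sets. If it ends in the reserve, it was pending before, so no new potential
  -- arises.
  record Placement (v : V) (tent : K) (σ τ : State) : Set (c ⊔ ℓ₂) where
    constructor placement
    field
      {PQ′ R′} : Subset n
      {cost}   : ℕ
      cost≤    : cost ℕ.≤ placeCost
      result   : τ ≡ charge cost (record σ { PQ = PQ′ ; R = R′ })
      PQ-other : ∀ {y} → y ≢ v → (y ∈ PQ′ → y ∈ PQ σ) × (y ∈ PQ σ → y ∈ PQ′)
      R-other  : ∀ {y} → y ≢ v → (y ∈ R′ → y ∈ R σ) × (y ∈ R σ → y ∈ R′)
      self     : (v ∈ PQ′ × v ∉ R′) ⊎ (v ∈ R′ × v ∉ PQ′ × P σ <⁺ [ tent ] × Pending σ v)

  same : ∀ {p : Subset n} {v y : V} → y ≢ v → (y ∈ p → y ∈ p) × (y ∈ p → y ∈ p)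
  same _ = id , id

  insert-other : ∀ {p : Subset n} {v y : V} → y ≢ v → (y ∈ p ∪ ⁅ v ⁆ → y ∈ p) × (y ∈ p → y ∈ p ∪ ⁅ v ⁆)
  insert-other {p} {v} y≢v =
    (λ y∈ → [ id , (λ y∈v → ⊥-elim (y≢v (x∈⁅y⁆⇒x≡y v y∈v))) ]′ (x∈p∪q⁻ p ⁅ v ⁆ y∈)) , x∈p∪q⁺ ∘ inj₁

  remove-other : ∀ {p : Subset n} {v y : V} → y ≢ v → (y ∈ p - v → y ∈ p) × (y ∈ p → y ∈ p - v)
  remove-other {p} {v} y≢v = p─q⊆p p ⁅ v ⁆ , λ y∈p → x∈p∧x≢y⇒x∈p-y y∈p y≢v

  v∉p-v : ∀ (p : Subset n) v → v ∉ p - v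
  v∉p-v p v v∈ = p─q⇒∉q p ⁅ v ⁆ v∈ (x∈⁅x⁆ v)

  place-placement : ∀ {u rem σ} v tent → Core u rem σ → Unsettled σ v → Placement v tent σ (place v tent σ)
  place-placement {σ = σ} v tent core uv with d σ v in eq
  ... | ⊤⁺ = if-elim (Placement v tent σ) ([ tent ] ≤⁺? P σ)
    (λ _ → placement insert≤ refl insert-other same
      (inj₁ (x∈p∪q⁺ (inj₂ (x∈⁅x⁆ v)) , λ v∈R → Core.R-labelled core v∈R eq)))
    (λ P<tent → placement reserve≤ refl same insert-other
      (inj₂ (x∈p∪q⁺ (inj₂ (x∈⁅x⁆ v)) , (λ v∈PQ → Core.PQ-labelled core v∈PQ eq) , P<tent , inj₁ eq)))
    where
    insert≤ : insert ℕ.≤ placeCost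
    insert≤ = ℕ.≤-trans (ℕ.m≤m+n insert reserve) (ℕ.m≤m+n _ decrease)
    reserve≤ : reserve ℕ.≤ placeCost
    reserve≤ = ℕ.≤-trans (ℕ.m≤n+m reserve insert) (ℕ.m≤m+n _ decrease)
  ... | [ _ ] = if-elim (Placement v tent σ) (v ∈? R σ)
    (λ v∈R → if-elim (Placement v tent σ) ([ tent ] ≤⁺? P σ)
      (λ _ → placement move≤ refl insert-other remove-other
        (inj₁ (x∈p∪q⁺ (inj₂ (x∈⁅x⁆ v)) , v∉p-v (R σ) v)))
      (λ P<tent → placement reserve≤ refl same same
        (inj₂ (v∈R , (λ v∈PQ → Core.disjoint core v∈PQ v∈R) , P<tent , inj₂ v∈R))))
    (λ v∉R → placement (ℕ.m≤n+m decrease _) refl same same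
      (inj₁ ([ (λ ()) , [ id , (λ v∈R → ⊥-elim (v∉R v∈R)) ]′ ]′ uv , v∉R)))
    where
    move≤ : reserve + insert ℕ.≤ placeCost
    move≤ = ℕ.≤-trans (ℕ.≤-reflexive (ℕ.+-comm reserve insert)) (ℕ.m≤m+n _ decrease)
    reserve≤ : reserve ℕ.≤ placeCost
    reserve≤ = ℕ.≤-trans (ℕ.m≤n+m reserve insert) (ℕ.m≤m+n _ decrease)

  -- The state while the out-edges of u are scanned, where σ₀ is the state just
  -- after the removal of u.
  record Active (σ₀ : State) (k : ℕ) (u : V) (du : K) (rem : List V) (σ : State) : Set (c ⊔ ℓ₁ ⊔ ℓ₂) where
    field
      core     : Core u rem σ
      bounded  : Bounded σ
      scanning : Scanning u du σ
      shrunk   : ∀ {v} → Unsettled σ v → Unsettled σ₀ v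
      paid     : time σ + Φ σ + length rem * edgeCost ℕ.≤ k

  -- The sets after `place` are variables, so its branches are treated together. The node `v` is
  -- unsettled before and after, hence settled nodes and their labels do not change.
  module Relabel {u v rem σ} {du : K} {PQ′ R′ : Subset n} {k : ℕ}
    (core : Core u (v ∷ rem) σ) (scanning : Scanning u du σ) (e : Edge u v)
    (tent< : [ du +ᴷ w u v ] <⁺ d σ v) (uv : Unsettled σ v)
    (PQ-other : ∀ {y} → y ≢ v → (y ∈ PQ′ → y ∈ PQ σ) × (y ∈ PQ σ → y ∈ PQ′))
    (R-other  : ∀ {y} → y ≢ v → (y ∈ R′ → y ∈ R σ) × (y ∈ R σ → y ∈ R′))
    (self     : (v ∈ PQ′ × v ∉ R′) ⊎ (v ∈ R′ × v ∉ PQ′ × P σ <⁺ [ du +ᴷ w u v ] × Pending σ v))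
    where

    open Core core
    open Scanning scanning

    τ : State
    τ = setLabel v (du +ᴷ w u v) (charge k (record σ { PQ = PQ′ ; R = R′ }))

    label-v : d τ v ≡ [ du +ᴷ w u v ]
    label-v = updateAt-updates v (d σ)

    label-other : ∀ {y} → y ≢ v → d τ y ≡ d σ y
    label-other {y} y≢v = updateAt-minimal y v (d σ) y≢v

    lowered : ∀ y → d τ y ≤⁺ d σ y
    lowered y with y ≟ v
    ... | yes refl = ≤⁺.trans (≡⇒≤⁺ label-v) (<⁺⇒≤⁺ tent<)
    ... | no y≢v   = ≡⇒≤⁺ (label-other y≢v)

    v-labelled : d τ v ≢ ⊤⁺
    v-labelled v≡⊤ with () ← trans (sym label-v) v≡⊤

    unlabelled⁻ : ∀ {y} → d τ y ≡ ⊤⁺ → d σ y ≡ ⊤⁺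
    unlabelled⁻ {y} y≡⊤ with y ≟ v
    ... | yes refl = ⊥-elim (v-labelled y≡⊤)
    ... | no y≢v   = trans (sym (label-other y≢v)) y≡⊤

    unsettled⁻ : ∀ {y} → Unsettled τ y → Unsettled σ y
    unsettled⁻ (inj₁ y≡⊤) = inj₁ (unlabelled⁻ y≡⊤)
    unsettled⁻ {y} (inj₂ uy) with y ≟ v
    ... | yes refl = uv
    unsettled⁻ (inj₂ (inj₁ y∈PQ)) | no y≢v = inj₂ (inj₁ (proj₁ (PQ-other y≢v) y∈PQ))
    unsettled⁻ (inj₂ (inj₂ y∈R))  | no y≢v = inj₂ (inj₂ (proj₁ (R-other y≢v) y∈R))

    unsettled⁺ : ∀ {y} → Unsettled σ y → Unsettled τ y
    unsettled⁺ {y} uy with y ≟ v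
    ... | yes refl = [ inj₂ ∘ inj₁ ∘ proj₁ , inj₂ ∘ inj₂ ∘ proj₁ ]′ self
    unsettled⁺ (inj₁ y≡⊤)         | no y≢v = inj₁ (trans (label-other y≢v) y≡⊤)
    unsettled⁺ (inj₂ (inj₁ y∈PQ)) | no y≢v = inj₂ (inj₁ (proj₂ (PQ-other y≢v) y∈PQ))
    unsettled⁺ (inj₂ (inj₂ y∈R))  | no y≢v = inj₂ (inj₂ (proj₂ (R-other y≢v) y∈R))

    pending⁻ : ∀ {y} → Pending τ y → Pending σ y
    pending⁻ (inj₁ y≡⊤) = inj₁ (unlabelled⁻ y≡⊤)
    pending⁻ {y} (inj₂ y∈R) with y ≟ v
    ... | yes refl = [ (λ (_ , v∉R) → ⊥-elim (v∉R y∈R)) , (λ (_ , _ , _ , pv) → pv) ]′ self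
    ... | no y≢v   = inj₂ (proj₁ (R-other y≢v) y∈R)

    -- Labels only fall, so a key now above `P` was above it before.
    fresh⁻ : ∀ {y} → Fresh τ y → Fresh σ y
    fresh⁻ (inj₁ y≡⊤) = inj₁ (unlabelled⁻ y≡⊤)
    fresh⁻ {y} (inj₂ (y∈R , P<dy)) with pending⁻ {y} (inj₂ y∈R)
    ... | inj₁ y≡⊤  = inj₁ y≡⊤
    ... | inj₂ y∈R′ = inj₂ (y∈R′ , <⁺-≤⁺-trans P<dy (lowered y))

    settled⇒≢v : ∀ {x} → Settled σ x → x ≢ v
    settled⇒≢v sx refl = sx uv

    settled⁻ : ∀ {x} → Settled τ x → Settled σ x
    settled⁻ sx = sx ∘ unsettled⁺

    settled⁺ : ∀ {x} → Settled σ x → Settled τ x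
    settled⁺ sx = sx ∘ unsettled⁻

    label-settled : ∀ {x} → Settled σ x → d τ x ≡ d σ x
    label-settled sx = label-other (settled⇒≢v sx)

    core⁺ : Core u rem τ
    core⁺ = record
      { source         = ≤⁺.trans (lowered s) source
      ; PQ-labelled    = λ {y} → PQ-labelled′ y
      ; R-labelled     = λ {y} → R-labelled′ y
      ; disjoint       = λ {y} → disjoint′ y
      ; reached        = λ {y} → reached′ y
      ; settled≤       = λ {x} {y} → settled≤′ x y
      ; target         = unsettled⁺ ∘ target
      ; reserved       = λ {y} → reserved′ y
      ; reserve-finite = λ {y} → reserve-finite′ y
      ; relaxed        = λ {x} {y} → relaxed′ x y
      ; P>0            = P>0
      ; early          = early
      }
      where
      PQ-labelled′ : ∀ y → y ∈ PQ′ → d τ y ≢ ⊤⁺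
      PQ-labelled′ y y∈ with y ≟ v
      ... | yes refl = v-labelled
      ... | no y≢v   = PQ-labelled (proj₁ (PQ-other y≢v) y∈) ∘ unlabelled⁻

      R-labelled′ : ∀ y → y ∈ R′ → d τ y ≢ ⊤⁺
      R-labelled′ y y∈ with y ≟ v
      ... | yes refl = v-labelled
      ... | no y≢v   = R-labelled (proj₁ (R-other y≢v) y∈) ∘ unlabelled⁻

      disjoint′ : ∀ y → y ∈ PQ′ → y ∉ R′
      disjoint′ y y∈PQ y∈R with y ≟ v
      ... | yes refl = [ (λ (_ , v∉R) → v∉R y∈R) , (λ (_ , v∉PQ , _) → v∉PQ y∈PQ) ]′ self
      ... | no y≢v   = disjoint (proj₁ (PQ-other y≢v) y∈PQ) (proj₁ (R-other y≢v) y∈R)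

      reached-old : ∀ {y} → y ≢ v → d σ y ≢ ⊤⁺ → Reached (d τ) (Settled τ) y
      reached-old y≢v y≢⊤ = Reached-map settled⁺ label-settled (label-other y≢v) (reached y≢⊤)

      reached′ : ∀ y → d τ y ≢ ⊤⁺ → Reached (d τ) (Settled τ) y
      reached′ y y≢⊤ with y ≟ v
      ... | no y≢v   = reached-old y≢v (λ y≡⊤ → y≢⊤ (trans (label-other y≢v) y≡⊤))
      ... | yes refl = child (reached-old (settled⇒≢v settled) (settled⇒labelled {σ} settled)) (settled⁺ settled) e
        (subst (_≈⁺ d τ u +⁺ w u v) (sym label-v)
          (subst (λ x → _ ≈⁺ x +⁺ w u v) (sym (trans (label-settled settled) label)) ≤⁺.Eq.refl))

      settled≤′ : ∀ x y → Settled τ x → Unsettled τ y → d τ x ≤⁺ d τ y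
      settled≤′ x y sx uy rewrite label-settled (settled⁻ sx) with y ≟ v
      -- Weights are nonnegative, so the new label is at least `du`, which dominates all settled
      -- labels.
      ... | yes refl rewrite label-v = ≤⁺.trans (latest (settled⁻ sx)) [ x≤x+y (w≥0 e) ]
      ... | no y≢v = subst (d σ x ≤⁺_) (sym (label-other y≢v)) (settled≤ (settled⁻ sx) (unsettled⁻ uy))

      reserved′ : ∀ y → y ∈ R′ → P σ <⁺ d τ y ⊎ B σ <⁺ d τ y
      reserved′ y y∈ with y ≟ v
      ... | yes refl rewrite label-v =
        [ (λ (_ , v∉R) → ⊥-elim (v∉R y∈)) , (λ (_ , _ , P<tent , _) → inj₁ P<tent) ]′ self
      ... | no y≢v rewrite label-other y≢v = reserved (proj₁ (R-other y≢v) y∈)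

      reserve-finite′ : ∀ y → y ∈ R′ → P σ ≢ ⊤⁺
      reserve-finite′ y y∈ with y ≟ v
      ... | yes refl = [ (λ (_ , v∉R) → ⊥-elim (v∉R y∈))
                       , (λ (_ , _ , P<tent , _) P≡⊤ → P<tent (subst (_ ≤⁺_) (sym P≡⊤) (_ ≤⊤⁺))) ]′ self
      ... | no y≢v   = reserve-finite (proj₁ (R-other y≢v) y∈)

      relaxed′ : ∀ x y → Settled τ x → Edge x y →
                 (x ≡ u × y ∈ˡ rem) ⊎ (B σ <⁺ d τ x +⁺ w x y) ⊎ (d τ y ≤⁺ d τ x +⁺ w x y)
      relaxed′ x y sx e′ rewrite label-settled (settled⁻ sx) with relaxed (settled⁻ sx) e′
      ... | inj₁ (refl , here refl) rewrite label-v | label = inj₂ (inj₂ ≤⁺.refl)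
      ... | inj₁ (refl , there y∈)  = inj₁ (refl , y∈)
      ... | inj₂ (inj₁ B<)          = inj₂ (inj₁ B<)
      ... | inj₂ (inj₂ dy≤)         = inj₂ (inj₂ (≤⁺.trans (lowered y) dy≤))

    scanning⁺ : Scanning u du τ
    scanning⁺ = record
      { label   = trans (label-settled settled) label
      ; settled = settled⁺ settled
      ; latest  = λ sx → subst (_≤⁺ _) (sym (label-settled (settled⁻ sx))) (latest (settled⁻ sx))
      }

    Φ-decreases : Φ τ ℕ.≤ Φ σ
    Φ-decreases = Φ-mono {σ} {τ} unsettled⁻ pending⁻ fresh⁻

  -- `B` occurs in the invariant only as a strict lower bound.
  core-lower-bound : ∀ {u rem σ B′} → B′ ≤⁺ B σ → Core u rem σ → Core u rem (record σ { B = B′ })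
  core-lower-bound {u} {rem} {σ} {B′} B′≤B core = record
    { Core core
    ; reserved = λ v∈R → [ inj₁ , inj₂ ∘ ≤⁺-<⁺-trans B′≤B ]′ (Core.reserved core v∈R)
    ; relaxed  = λ sx e → [ inj₁ , inj₂ ∘ [ inj₁ ∘ ≤⁺-<⁺-trans B′≤B , inj₂ ]′ ]′ (Core.relaxed core sx e)
    }

  core-skip : ∀ {u v rem σ} → Core u (v ∷ rem) σ →
              (B σ <⁺ d σ u +⁺ w u v) ⊎ (d σ v ≤⁺ d σ u +⁺ w u v) → Core u rem σ
  core-skip {u} {v} {rem} {σ} core skip = record { Core core ; relaxed = relaxed′ }
    where
    relaxed′ : ∀ {x y} → Settled σ x → Edge x y →
               (x ≡ u × y ∈ˡ rem) ⊎ (B σ <⁺ d σ x +⁺ w x y) ⊎ (d σ y ≤⁺ d σ x +⁺ w x y)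
    relaxed′ sx e with Core.relaxed core sx e
    ... | inj₁ (refl , here refl) = inj₂ skip
    ... | inj₁ (refl , there y∈)  = inj₁ (refl , y∈)
    ... | inj₂ r                  = inj₂ r

  -- The bound falls before `v` is relabelled, so `Bounded` may fail in between. The last component
  -- therefore promises it for any later labelling that is nowhere larger and gives `v` at most
  -- `tent`.
  improveBound-form : ∀ v tent σ → Bounded σ → ∃ λ B′ →
    improveBound v tent σ ≡ record σ { B = B′ } × B′ ≤⁺ B σ ×
    (∀ (δ : Vector (K ⁺) n) → (∀ y → δ y ≤⁺ d σ y) → δ v ≤⁺ [ tent ] → ∃ λ t → t ∈ T × δ t ≤⁺ B′)
  improveBound-form v tent σ (t , t∈T , dt≤B) with v ∈? T
  ... | no _ = B σ , refl , ≤⁺.refl , λ δ lower _ → t , t∈T , ≤⁺.trans (lower t) dt≤B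
  ... | yes v∈T = [ tent ] ⊓⁺ B σ , refl , ⊓⁺.x⊓y≤y [ tent ] (B σ) , bounded
    where
    bounded : ∀ (δ : Vector (K ⁺) n) → (∀ y → δ y ≤⁺ d σ y) → δ v ≤⁺ [ tent ] →
              ∃ λ t → t ∈ T × δ t ≤⁺ [ tent ] ⊓⁺ B σ
    bounded δ lower δv≤ with ⊓⁺-sel [ tent ] (B σ)
    ... | inj₁ ≡tent = v , v∈T , subst (δ v ≤⁺_) (sym ≡tent) δv≤
    ... | inj₂ ≡B    = t , t∈T , subst (δ t ≤⁺_) (sym ≡B) (≤⁺.trans (lower t) dt≤B)

  -- The credit `e` held for one edge covers its actual cost `c`; `r` is the credit of the edges
  -- still to come.
  pay : ∀ {k e r} t φ φ′ c → c ℕ.≤ e → φ′ ℕ.≤ φ → t + φ + (e + r) ℕ.≤ k → t + c + φ′ + r ℕ.≤ k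
  pay {k} {e} {r} t φ φ′ c c≤e φ′≤φ paid = begin
    t + c + φ′ + r    ≤⟨ ℕ.+-monoˡ-≤ r (ℕ.+-mono-≤ (ℕ.+-monoʳ-≤ t c≤e) φ′≤φ) ⟩
    t + e + φ + r     ≡⟨ rearrange t e φ r ⟩
    t + φ + (e + r)   ≤⟨ paid ⟩
    k                 ∎
    where
    open ℕ.≤-Reasoning
    rearrange : ∀ t e φ r → t + e + φ + r ≡ t + φ + (e + r)
    rearrange = solve-∀

  scanEdge-active : ∀ {σ₀ k u du v rem σ} → Edge u v → Active σ₀ k u du (v ∷ rem) σ →
                    Active σ₀ k u du rem (scanEdge v (du +ᴷ w u v) σ)
  scanEdge-active {σ₀} {k} {u} {du} {v} {rem} {σ} e active =
    if-elim (λ τ → Active σ₀ k u du rem (charge scan τ)) ([ tent ] ≤⁺? B σ) (λ _ → scanned) pruned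
    where
    open Active active
    open Scanning scanning
    tent = du +ᴷ w u v
    form = improveBound-form v tent σ bounded
    B′ = proj₁ form

    bounded′ : ∀ (δ : Vector (K ⁺) n) → (∀ y → δ y ≤⁺ d σ y) → δ v ≤⁺ [ tent ] → ∃ λ t → t ∈ T × δ t ≤⁺ B′
    bounded′ = proj₂ (proj₂ (proj₂ form))

    -- Settled nodes are never relabelled: their labels are at most `du`, and weights are
    -- nonnegative.
    unsettled-v : [ tent ] <⁺ d σ v → Unsettled σ v
    unsettled-v tent< with unsettled? σ v
    ... | yes uv = uv
    ... | no sv  = ⊥-elim (tent< (≤⁺.trans (latest sv) [ x≤x+y (w≥0 e) ]))

    σ′ : State
    σ′ = record σ { B = B′ }

    core′ : Core u (v ∷ rem) σ′
    core′ = core-lower-bound (proj₁ (proj₂ (proj₂ form))) core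

    scanning′ : Scanning u du σ′
    scanning′ = record { Scanning scanning }

    pruned : ¬ ([ tent ] ≤⁺ B σ) → Active σ₀ k u du rem (charge scan σ)
    pruned B<tent = record
      { core     = record { Core (core-skip core (inj₁ (subst (λ x → B σ <⁺ x +⁺ w u v) (sym label) B<tent))) }
      ; bounded  = bounded
      ; scanning = record { Scanning scanning }
      ; shrunk   = shrunk
      ; paid     = pay (time σ) (Φ σ) _ scan (ℕ.m≤m+n scan placeCost) ℕ.≤-refl paid
      }

    kept : d σ v ≤⁺ [ tent ] → Active σ₀ k u du rem (charge scan σ′)
    kept dv≤ = record
      { core     = record { Core (core-skip core′ (inj₂ (subst (λ x → d σ v ≤⁺ x +⁺ w u v) (sym label) dv≤))) }
      ; bounded  = bounded′ (d σ) (λ _ → ≤⁺.refl) dv≤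
      ; scanning = record { Scanning scanning }
      ; shrunk   = shrunk
      ; paid     = pay (time σ) (Φ σ) _ scan (ℕ.m≤m+n scan placeCost) ℕ.≤-refl paid
      }

    relabelled : [ tent ] <⁺ d σ v → ∀ {ρ} → Placement v tent σ′ ρ → Active σ₀ k u du rem (charge scan (setLabel v tent ρ))
    relabelled tent< (placement {PQ′} {R′} {cost} cost≤ refl PQ-other R-other self) = record
      { core     = record { Core (Rel.core⁺) }
      ; bounded  = bounded′ _ Rel.lowered
                     (≡⇒≤⁺ Rel.label-v)
      ; scanning = record { Scanning (Rel.scanning⁺) }
      ; shrunk   = shrunk ∘ Rel.unsettled⁻
      ; paid     = subst (λ t → t + Φ Rel.τ + length rem * edgeCost ℕ.≤ k) (sym (ℕ.+-assoc (time σ) cost scan))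
                     (pay (time σ) (Φ σ) (Φ Rel.τ) (cost + scan)
                       (ℕ.≤-trans (ℕ.≤-reflexive (ℕ.+-comm cost scan)) (ℕ.+-monoʳ-≤ scan cost≤))
                       Rel.Φ-decreases paid)
      }
      where
      module Rel = Relabel {k = cost} core′ scanning′ e tent< (unsettled-v tent<) PQ-other R-other self

    scanned : Active σ₀ k u du rem (charge scan (relax v tent (improveBound v tent σ)))
    scanned = subst (λ τ → Active σ₀ k u du rem (charge scan (relax v tent τ))) (sym (proj₁ (proj₂ form)))
      (if-elim (λ τ → Active σ₀ k u du rem (charge scan τ)) (d σ v ≤⁺? [ tent ]) kept
        (λ tent< → relabelled tent< (place-placement v tent core′ (unsettled-v tent<))))

  scanEdges-active : ∀ {σ₀ k u du} rem → All (Edge u) rem → ∀ {σ} → Active σ₀ k u du rem σ →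
                     Active σ₀ k u du [] (foldl (λ τ v → scanEdge v (du +ᴷ w u v) τ) σ rem)
  scanEdges-active []        []       active = active
  scanEdges-active (v ∷ rem) (e ∷ es) active = scanEdges-active rem es (scanEdge-active e active)

  -- Iterations

  record Inv (k : ℕ) (σ : State) : Set (c ⊔ ℓ₁ ⊔ ℓ₂) where
    field
      {node}  : V
      core    : Core node [] σ
      bounded : Bounded σ
      paid    : time σ + Φ σ ℕ.≤ k

  removalCost≤ : ∀ σ → loop + delete * (1 + ⌈log₂ ∣ PQ σ ∣ ⌉) ℕ.≤ removalCost
  removalCost≤ σ = ℕ.+-monoʳ-≤ loop (ℕ.*-monoʳ-≤ delete (ℕ.+-monoʳ-≤ 1 (⌈log₂⌉-mono-≤ (∣p∣≤n (PQ σ)))))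

  module Iteration {k σ} (inv : Inv k σ) {u du} (min : IsMinimum σ u) (du≤P : d σ u ≤⁺ P σ)
    (u∉T : u ∉ T) (label-u : d σ u ≡ [ du ]) where

    open Inv inv
    open Core core
    open IsMinimum min

    removed : State
    removed = removeMin u σ

    unsettled⁻ : ∀ {y} → Unsettled removed y → Unsettled σ y
    unsettled⁻ = [ inj₁ , [ inj₂ ∘ inj₁ ∘ p─q⊆p (PQ σ) ⁅ u ⁆ , inj₂ ∘ inj₂ ]′ ]′

    unsettled⁺ : ∀ {y} → y ≢ u → Unsettled σ y → Unsettled removed y
    unsettled⁺ y≢u = [ inj₁ , [ (λ y∈PQ → inj₂ (inj₁ (x∈p∧x≢y⇒x∈p-y y∈PQ y≢u))) , inj₂ ∘ inj₂ ]′ ]′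

    u-settled : Settled removed u
    u-settled (inj₁ u≡⊤)         = PQ-labelled queued u≡⊤
    u-settled (inj₂ (inj₁ u∈PQ)) = v∉p-v (PQ σ) u u∈PQ
    u-settled (inj₂ (inj₂ u∈R))  = disjoint queued u∈R

    settled⁺ : ∀ {x} → Settled σ x → Settled removed x
    settled⁺ sx = sx ∘ unsettled⁻

    settled⁻ : ∀ {x} → Settled removed x → x ≡ u ⊎ Settled σ x
    settled⁻ {x} sx with x ≟ u
    ... | yes x≡u = inj₁ x≡u
    ... | no x≢u  = inj₂ (sx ∘ unsettled⁺ x≢u)

    -- Only `u` becomes settled. By `minimum≤unsettled` its label is at most every remaining one,
    -- and all its out-edges are outstanding.
    removed-core : Core u (adj u) removed
    removed-core = record
      { Core core
      ; PQ-labelled = PQ-labelled ∘ p─q⊆p (PQ σ) ⁅ u ⁆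
      ; disjoint    = disjoint ∘ p─q⊆p (PQ σ) ⁅ u ⁆
      ; reached     = λ y≢⊤ → Reached-map settled⁺ (λ _ → refl) refl (reached y≢⊤)
      ; settled≤    = λ sx uy → [ (λ { refl → minimum≤unsettled core bounded min du≤P (unsettled⁻ uy) })
                                , (λ sx′ → settled≤ sx′ (unsettled⁻ uy)) ]′ (settled⁻ sx)
      ; target      = λ t∈T → unsettled⁺ (λ { refl → u∉T t∈T }) (target t∈T)
      ; relaxed     = λ sx e → [ (λ { refl → inj₁ (refl , e) })
                               , (λ sx′ → [ (λ { (_ , ()) }) , inj₂ ]′ (relaxed sx′ e)) ]′ (settled⁻ sx)
      ; early       = early ∘ ℕ.<⇒≤
      }

    removed-scanning : Scanning u du removed
    removed-scanning = record
      { label   = label-u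
      ; settled = u-settled
      ; latest  = λ sx → [ (λ { refl → ≡⇒≤⁺ label-u })
                         , (λ sx′ → ≤⁺.trans (settled≤ sx′ (inj₂ (inj₁ queued))) (≡⇒≤⁺ label-u)) ]′ (settled⁻ sx)
      }

    -- The term of `u` leaves `Φ₁`: one part of `nodeCost u` pays for the removal, the other becomes
    -- the credit for its out-edges.
    removed-paid : time removed + Φ removed + length (adj u) * edgeCost ℕ.≤ k
    removed-paid = begin
      t + r′ + (Φ₁ removed + φ) + a   ≤⟨ ℕ.+-monoˡ-≤ a (ℕ.+-mono-≤ (ℕ.+-monoʳ-≤ t (removalCost≤ σ))
                                          (ℕ.+-monoʳ-≤ (Φ₁ removed) (Φ₂₃-mono {σ} {removed} id id))) ⟩
      t + r + (Φ₁ removed + φ) + a    ≡⟨ rearrange t r (Φ₁ removed) φ a ⟩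
      t + (Φ₁ removed + (r + a) + φ)  ≤⟨ ℕ.+-monoʳ-≤ t (ℕ.+-monoˡ-≤ φ
                                          (∑-when-remove (unsettled? removed) (unsettled? σ) nodeCost u
                                            unsettled⁻ (inj₂ (inj₁ queued)) u-settled)) ⟩
      t + (Φ₁ σ + φ)                  ≤⟨ paid ⟩
      k                               ∎
      where
      open ℕ.≤-Reasoning
      t  = time σ
      r′ = loop + delete * (1 + ⌈log₂ ∣ PQ σ ∣ ⌉)
      r  = removalCost
      a  = length (adj u) * edgeCost
      φ  = Φ₂ σ + Φ₃ σ
      rearrange : ∀ t r φ₁ φ a → t + r + (φ₁ + φ) + a ≡ t + (φ₁ + (r + a) + φ)
      rearrange = solve-∀

    -- The removal already counts as an iteration: `suc i ≤ i₀` is by definition `i < i₀`.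
    untrained : iterations removed ℕ.≤ i₀ → P removed ≡ ⊤⁺
    untrained = early

    extended-active : ∀ {X′} → Active removed k u du (adj u) (record removed { X = X′ })
    extended-active = record
      { core     = record { Core removed-core }
      ; bounded  = bounded
      ; scanning = record { Scanning removed-scanning }
      ; shrunk   = id
      ; paid     = removed-paid
      }

    -- Up to this iteration `P` was infinite and nothing could be reserved, so every condition on
    -- reserved nodes holds vacuously for the new `P`.
    predicted-active : ∀ {X′ p} → 0# < p → iterations removed ≡ i₀ →
                       Active removed k u du (adj u) (record removed { X = X′ ; P = [ p ] })
    predicted-active {X′} {p} 0<p now = record
      { core     = record
        { Core removed-core
        ; reserved       = λ v∈R → ⊥-elim (R-empty v∈R)
        ; reserve-finite = λ v∈R → ⊥-elim (R-empty v∈R)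
        ; P>0            = λ { [ p≤0 ] → 0<p p≤0 }
        ; early          = λ it<i₀ → ⊥-elim (ℕ.<⇒≢ it<i₀ now)
        }
      ; bounded  = bounded
      ; scanning = record { Scanning removed-scanning }
      ; shrunk   = id
      ; paid     = ℕ.≤-trans (ℕ.+-monoˡ-≤ (length (adj u) * edgeCost) (ℕ.+-monoʳ-≤ (time removed)
                     (Φ-mono {removed} {record removed { X = X′ ; P = [ p ] }} id id
                       [ inj₁ , (λ (v∈R , _) → ⊥-elim (R-empty v∈R)) ]′)))
                     removed-paid
      }
      where
      R-empty : ∀ {v} → v ∉ R σ
      R-empty v∈R = reserve-finite v∈R (untrained (ℕ.≤-reflexive now))

    prediction-pos : ∀ X′ → 0# < α *ᴷ prediction X′
    prediction-pos X′ αp≤0 =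
      prediction>0 X′ (≤ᴷ.trans (scale-≤ 1≤α (<⇒≤ (prediction>0 X′))) αp≤0)

    prepared : Active removed k u du (adj u) (predict (extendTrace du removed))
    prepared = if-elim (λ τ → Active removed k u du (adj u) (predict τ)) (iterations removed ℕ.≤? i₀)
      (λ _ → predicted) (λ _ → predicted)
      where
      predicted : ∀ {X′} → Active removed k u du (adj u) (predict (record removed { X = X′ }))
      predicted {X′} = if-elim (Active removed k u du (adj u)) (iterations removed ℕ.≟ i₀)
        (predicted-active (prediction-pos X′)) (λ _ → extended-active)

    expanded : Active removed k u du [] (expand u du σ)
    expanded = scanEdges-active (adj u) (All.tabulate id) prepared

    expand-inv : Inv k (expand u du σ)
    expand-inv = record
      { core    = Active.core expanded
      ; bounded = Active.bounded expanded
      ; paid    = ℕ.≤-trans (ℕ.≤-reflexive (sym (ℕ.+-identityʳ _))) (Active.paid expanded)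
      }

    fewer-unsettled : ∑ (λ v → when (unsettled? (expand u du σ) v) 1) ℕ.< ∑ (λ v → when (unsettled? σ v) 1)
    fewer-unsettled = ℕ.≤-trans (ℕ.≤-reflexive (ℕ.+-comm 1 _))
      (∑-when-remove (unsettled? (expand u du σ)) (unsettled? σ) (const 1) u
        (unsettled⁻ ∘ Active.shrunk expanded) (inj₂ (inj₁ queued)) (Scanning.settled (Active.scanning expanded)))

  -- Calls of Update-Prediction

  -- In a nonempty bucket the nodes can pay for `call` as well, and an empty bucket is free.
  bucketCost≤ : ∀ b → bucketCost b ℕ.≤ visitCost * b
  bucketCost≤ 0           = ℕ.z≤n
  bucketCost≤ b@(ℕ.suc _) = ℕ.≤-trans
    (ℕ.+-monoˡ-≤ (visit * b) (ℕ.m≤m*n call b)) (ℕ.≤-reflexive (sym (ℕ.*-distribʳ-+ b call visit)))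

  module Update {k σ} (inv : Inv k σ) where

    open Inv inv
    open Core core

    τ : State
    τ = updatePrediction σ

    released? : ∀ v → Dec (v ∈ R σ × d σ v ≤⁺ (β *⁺ P σ) × d σ v ≤⁺ B σ)
    released? v = v ∈? R σ ×-dec d σ v ≤⁺? (β *⁺ P σ) ×-dec d σ v ≤⁺? B σ

    bucket? : ∀ v → Dec (v ∈ R σ × P σ <⁺ d σ v × d σ v ≤⁺ (β *⁺ P σ))
    bucket? v = v ∈? R σ ×-dec ¬? (d σ v ≤⁺? P σ) ×-dec d σ v ≤⁺? (β *⁺ P σ)

    P≤βP : P σ ≤⁺ β *⁺ P σ
    P≤βP = scale-≤⁺ (<⇒≤ 1<β) (<⁺⇒≤⁺ P>0)

    R⁻ : ∀ {v} → v ∈ R τ → v ∈ R σ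
    R⁻ = p─q⊆p (R σ) (released σ)

    unsettled⁻ : ∀ {v} → Unsettled τ v → Unsettled σ v
    unsettled⁻ (inj₁ v≡⊤)         = inj₁ v≡⊤
    unsettled⁻ (inj₂ (inj₁ v∈PQ)) = [ inj₂ ∘ inj₁ , inj₂ ∘ inj₂ ∘ proj₁ ∘ ∈-tabulate⁻ released? ]′
                                      (x∈p∪q⁻ (PQ σ) (released σ) v∈PQ)
    unsettled⁻ (inj₂ (inj₂ v∈R))  = inj₂ (inj₂ (R⁻ v∈R))

    unsettled⁺ : ∀ {v} → Unsettled σ v → Unsettled τ v
    unsettled⁺ (inj₁ v≡⊤)         = inj₁ v≡⊤
    unsettled⁺ (inj₂ (inj₁ v∈PQ)) = inj₂ (inj₁ (x∈p∪q⁺ (inj₁ v∈PQ)))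
    unsettled⁺ {v} (inj₂ (inj₂ v∈R)) with v ∈? released σ
    ... | yes v∈rel = inj₂ (inj₁ (x∈p∪q⁺ (inj₂ v∈rel)))
    ... | no v∉rel  = inj₂ (inj₂ (x∈p∧x∉q⇒x∈p─q v∈R v∉rel))

    PQ⁻ : ∀ {v} → v ∈ PQ τ → v ∈ PQ σ ⊎ v ∈ released σ
    PQ⁻ = x∈p∪q⁻ (PQ σ) (released σ)

    update-core : Core node [] τ
    update-core = record
      { Core core
      ; PQ-labelled    = [ PQ-labelled , R-labelled ∘ proj₁ ∘ ∈-tabulate⁻ released? ]′ ∘ PQ⁻
      ; R-labelled     = R-labelled ∘ R⁻
      ; disjoint       = λ v∈PQ v∈R → [ (λ v∈PQσ → disjoint v∈PQσ (R⁻ v∈R))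
                                      , p─q⇒∉q (R σ) (released σ) v∈R ]′ (PQ⁻ v∈PQ)
      ; reached        = λ y≢⊤ → Reached-map (_∘ unsettled⁻) (λ _ → refl) refl (reached y≢⊤)
      ; settled≤       = λ sx uy → settled≤ (sx ∘ unsettled⁺) (unsettled⁻ uy)
      ; target         = unsettled⁺ ∘ target
      ; reserved       = reserved′
      ; reserve-finite = λ v∈R βP≡⊤ → reserve-finite (R⁻ v∈R) (infinite⁻ βP≡⊤)
      ; relaxed        = λ sx → relaxed (sx ∘ unsettled⁺)
      ; P>0            = <⁺-≤⁺-trans P>0 P≤βP
      ; early          = λ it<i₀ → cong (β *⁺_) (early it<i₀)
      }
      where
      infinite⁻ : β *⁺ P σ ≡ ⊤⁺ → P σ ≡ ⊤⁺
      infinite⁻ βP≡⊤ with P σ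
      ... | ⊤⁺ = refl

      reserved′ : ∀ {v} → v ∈ R τ → (β *⁺ P σ <⁺ d σ v) ⊎ (B σ <⁺ d σ v)
      reserved′ {v} v∈R with d σ v ≤⁺? (β *⁺ P σ) | d σ v ≤⁺? B σ
      ... | no βP<dv | _       = inj₁ βP<dv
      ... | yes _    | no B<dv = inj₂ B<dv
      ... | yes ≤βP  | yes ≤B  =
        ⊥-elim (p─q⇒∉q (R σ) (released σ) v∈R (∈-tabulate⁺ released? (R⁻ v∈R , ≤βP , ≤B)))

    -- A released node is labelled and leaves the reserve, so it is no longer pending and its
    -- `insert` is freed.
    pending-split : Φ₂ τ + insert * ∣ released σ ∣ ℕ.≤ Φ₂ σ
    pending-split = subst (λ r → Φ₂ τ + r ℕ.≤ Φ₂ σ) (∑-when-const released? insert)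
      (∑-when-split (pending? τ) released? (pending? σ) (const insert)
        [ inj₁ , inj₂ ∘ R⁻ ]′ (inj₂ ∘ proj₁)
        (λ { (inj₁ v≡⊤) (v∈R , _) → R-labelled v∈R v≡⊤
           ; (inj₂ v∈R) rel       → p─q⇒∉q (R σ) (released σ) v∈R (∈-tabulate⁺ released? rel) }))

    -- The keys of the bucket are at most the new `P`, so its nodes cease to be fresh even if they
    -- stay reserved because of `B`.
    fresh-split : Φ₃ τ + visitCost * ∣ bucket σ ∣ ℕ.≤ Φ₃ σ
    fresh-split = subst (λ r → Φ₃ τ + r ℕ.≤ Φ₃ σ) (∑-when-const bucket? visitCost)
      (∑-when-split (fresh? τ) bucket? (fresh? σ) (const visitCost)
        [ inj₁ , (λ (v∈R , βP<) → inj₂ (R⁻ v∈R , ≤⁺-<⁺-trans P≤βP βP<)) ]′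
        (λ (v∈R , P< , _) → inj₂ (v∈R , P<))
        (λ { (inj₁ v≡⊤)       (v∈R , _)     → R-labelled v∈R v≡⊤
           ; (inj₂ (_ , βP<)) (_ , _ , ≤βP) → βP< ≤βP }))

    update-paid : time τ + Φ τ ℕ.≤ k
    update-paid = begin
      time σ + (bucketCost ∣ bucket σ ∣ + rel) + (Φ₁ τ + (Φ₂ τ + Φ₃ τ))
        ≤⟨ ℕ.+-mono-≤ (ℕ.+-monoʳ-≤ (time σ) (ℕ.+-monoˡ-≤ rel (bucketCost≤ ∣ bucket σ ∣)))
             (ℕ.+-monoˡ-≤ (Φ₂ τ + Φ₃ τ) (∑-when-mono (unsettled? τ) (unsettled? σ) nodeCost unsettled⁻)) ⟩
      time σ + (vis + rel) + (Φ₁ σ + (Φ₂ τ + Φ₃ τ))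
        ≡⟨ rearrange (time σ) vis rel (Φ₁ σ) (Φ₂ τ) (Φ₃ τ) ⟩
      time σ + (Φ₁ σ + ((Φ₂ τ + rel) + (Φ₃ τ + vis)))
        ≤⟨ ℕ.+-monoʳ-≤ (time σ) (ℕ.+-monoʳ-≤ (Φ₁ σ) (ℕ.+-mono-≤ pending-split fresh-split)) ⟩
      time σ + Φ σ
        ≤⟨ paid ⟩
      k ∎
      where
      open ℕ.≤-Reasoning
      rel = insert * ∣ released σ ∣
      vis = visitCost * ∣ bucket σ ∣
      rearrange : ∀ t v r a b c → t + (v + r) + (a + (b + c)) ≡ t + (a + ((b + r) + (c + v)))
      rearrange = solve-∀

    update-inv : Inv k τ
    update-inv = record { core = update-core ; bounded = bounded ; paid = update-paid }

  -- Executions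

  -- The time charged at the start plus the potential of a state in which every node is unsettled,
  -- pending and fresh.
  budget : ℕ
  budget = initialise * n + insert + (∑ nodeCost + (n * insert + n * visitCost))

  ∑-nodeCost : ∑ nodeCost ≡ n * removalCost + m * edgeCost
  ∑-nodeCost = trans (sum-map-+ (const removalCost) (λ v → length (adj v) * edgeCost) (allFin n))
    (cong₂ _+_ (∑-const n removalCost) (sum-map-*ʳ (length ∘ adj) edgeCost (allFin n)))

  -- Terms are grouped by `n`, `1`, `m` and `n * ⌈log₂ n ⌉`, each at most `1 + m + n * ⌈log₂ n ⌉`;
  -- the coefficients add up to the constant.
  budget≤ : budget ℕ.≤ runningConstant * (1 + m + n * ⌈log₂ n ⌉)
  budget≤ = begin
    budget
      ≡⟨ cong (λ x → initialise * n + insert + (x + (n * insert + n * visitCost))) ∑-nodeCost ⟩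
    initialise * n + insert + (n * removalCost + m * edgeCost + (n * insert + n * visitCost))
      ≡⟨ rearrange initialise insert loop delete visitCost edgeCost n m ⌈log₂ n ⌉ ⟩
    initialise * n + insert * 1 + (loop + delete + insert + visitCost) * n + delete * nL + edgeCost * m
      ≤⟨ ℕ.+-mono-≤ (ℕ.+-mono-≤ (ℕ.+-mono-≤ (ℕ.+-mono-≤
           (ℕ.*-monoʳ-≤ initialise n≤N) (ℕ.*-monoʳ-≤ insert 1≤N))
           (ℕ.*-monoʳ-≤ (loop + delete + insert + visitCost) n≤N))
           (ℕ.*-monoʳ-≤ delete nL≤N)) (ℕ.*-monoʳ-≤ edgeCost m≤N) ⟩
    initialise * N + insert * N + (loop + delete + insert + visitCost) * N + delete * N + edgeCost * N
      ≡⟨ collect initialise insert (loop + delete + insert + visitCost) delete edgeCost N ⟩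
    runningConstant * N ∎
    where
    open ℕ.≤-Reasoning
    nL = n * ⌈log₂ n ⌉
    N  = 1 + m + nL
    1≤N : 1 ℕ.≤ N
    1≤N = ℕ.s≤s ℕ.z≤n
    nL≤N : nL ℕ.≤ N
    nL≤N = ℕ.m≤n+m nL (1 + m)
    m≤N : m ℕ.≤ N
    m≤N = ℕ.≤-trans (ℕ.m≤n+m m 1) (ℕ.m≤m+n (1 + m) nL)
    n≤N : n ℕ.≤ N
    n≤N = ℕ.≤-trans (n≤1+n⌈log₂n⌉ n) (ℕ.s≤s (ℕ.m≤n+m nL m))
    rearrange : ∀ i j l x v e n m L →
      i * n + j + (n * (l + x * (1 + L)) + m * e + (n * j + n * v)) ≡
      i * n + j * 1 + (l + x + j + v) * n + x * (n * L) + e * m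
    rearrange = solve-∀
    collect : ∀ a b c d e N → a * N + b * N + c * N + d * N + e * N ≡ (a + b + c + d + e) * N
    collect = solve-∀

  -- Initialisation and invariance along executions

  module Initial (reachable : TargetReachable) where

    open Extrema ≤⁺.totalOrder using (argmin; argmin-all; f[argmin]≤f[xs])

    t₀ : V
    t₀ = proj₁ reachable

    t₀∈T : t₀ ∈ T
    t₀∈T = proj₁ (proj₂ reachable)

    p₀ : Walk s t₀
    p₀ = Path.walk (proj₂ (proj₂ reachable))

    initial-source : d initial s ≡ [ 0# ]
    initial-source = updateAt-updates s (const ⊤⁺)

    initial-other : ∀ {v} → v ≢ s → d initial v ≡ ⊤⁺
    initial-other {v} v≢s = updateAt-minimal v s (const ⊤⁺) v≢s

    initial-unsettled : ∀ v → Unsettled initial v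
    initial-unsettled v with v ≟ s
    ... | yes refl = inj₂ (inj₁ (x∈⁅x⁆ s))
    ... | no v≢s   = inj₁ (initial-other v≢s)

    initial-inv : Inv budget initial
    initial-inv = record
      { node    = s
      ; core    = record
        { source         = ≡⇒≤⁺ initial-source
        ; PQ-labelled    = PQ-labelled
        ; R-labelled     = ⊥-elim ∘ ∉⊥
        ; disjoint       = λ _ → ∉⊥
        ; reached        = reached
        ; settled≤       = λ {x} sx → ⊥-elim (sx (initial-unsettled x))
        ; target         = λ {t} _ → initial-unsettled t
        ; reserved       = ⊥-elim ∘ ∉⊥
        ; reserve-finite = ⊥-elim ∘ ∉⊥
        ; relaxed        = λ {x} sx → ⊥-elim (sx (initial-unsettled x))
        ; P>0            = λ ()
        ; early          = λ _ → refl
        }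
      ; bounded = t₀ , t₀∈T , (_ ≤⊤⁺)
      ; paid    = ℕ.+-monoʳ-≤ (initialise * n + insert) (ℕ.+-mono-≤
          (∑-when-≤ (unsettled? initial) nodeCost) (ℕ.+-mono-≤
          (ℕ.≤-trans (∑-when-≤ (pending? initial) (const insert)) (ℕ.≤-reflexive (∑-const n insert)))
          (ℕ.≤-trans (∑-when-≤ (fresh? initial) (const visitCost)) (ℕ.≤-reflexive (∑-const n visitCost)))))
      }
      where
      PQ-labelled : ∀ {v} → v ∈ ⁅ s ⁆ → d initial v ≢ ⊤⁺
      PQ-labelled v∈ v≡⊤ with refl ← x∈⁅y⁆⇒x≡y s v∈ with () ← trans (sym initial-source) v≡⊤

      reached : ∀ {v} → d initial v ≢ ⊤⁺ → Reached (d initial) (Settled initial) v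
      reached {v} v≢⊤ with v ≟ s
      ... | yes refl = root (≤⁺.Eq.reflexive initial-source)
      ... | no v≢s   = ⊥-elim (v≢⊤ (initial-other v≢s))

    -- For a stopped configuration the invariant is kept for the state before the last removal;
    -- afterwards a target would be settled.
    data Good : Configuration → Set (c ⊔ ℓ₁ ⊔ ℓ₂) where
      running : ∀ {σ} → Inv budget σ → Good (running σ)
      stopped : ∀ {σ u} → Inv budget σ → IsMinimum σ u → d σ u ≤⁺ P σ → u ∈ T → Good (stopped u (removeMin u σ))

    good-step : ∀ {γ γ′} → Good γ → γ ⟶ γ′ → Good γ′
    good-step (running inv) (stop min u≤P u∈T)           = stopped inv min u≤P u∈T
    good-step (running inv) (iterate min u≤P u∉T label) = running (Iteration.expand-inv inv min u≤P u∉T label)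
    good-step (running inv) (update _)                   = running (Update.update-inv inv)

    good-steps : ∀ {γ γ′} → Good γ → γ ⟶* γ′ → Good γ′
    good-steps good ε          = good
    good-steps good (st ◅ sts) = good-steps (good-step good st) sts

    good : ∀ {γ} → start ⟶* γ → Good γ
    good = good-steps (running initial-inv)

    -- The final removal is paid by the potential of the target, which is still queued in the state
    -- that carries the invariant.
    good-elapsed : ∀ {γ} → Good γ → elapsed γ ℕ.≤ budget
    good-elapsed (running inv) = ℕ.≤-trans (ℕ.m≤m+n _ _) (Inv.paid inv)
    good-elapsed (stopped {σ} {u} inv min _ _) = ℕ.≤-trans
      (ℕ.+-monoʳ-≤ (time σ) (begin
        loop + delete * (1 + ⌈log₂ ∣ PQ σ ∣ ⌉)  ≤⟨ removalCost≤ σ ⟩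
        removalCost                             ≤⟨ ℕ.m≤m+n removalCost _ ⟩
        nodeCost u                              ≡⟨ when-true (unsettled? σ u) (inj₂ (inj₁ (IsMinimum.queued min))) ⟨
        when (unsettled? σ u) (nodeCost u)      ≤⟨ f≤sum-map (λ v → when (unsettled? σ v) (nodeCost v)) (∈-allFin u) ⟩
        Φ₁ σ                                    ≤⟨ ℕ.m≤m+n (Φ₁ σ) _ ⟩
        Φ σ                                     ∎))
      (Inv.paid inv)
      where open ℕ.≤-Reasoning

    -- Progress and termination

    minimum-exists : ∀ σ {v} → v ∈ PQ σ → ∃ (IsMinimum σ)
    minimum-exists σ {v} v∈PQ = argmin (d σ) v queue , record
      { queued = argmin-all (d σ) {P = _∈ PQ σ} v∈PQ (all-filter (_∈? PQ σ) (allFin n))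
      ; least  = λ {y} y∈PQ → All.lookup (f[argmin]≤f[xs] v queue) (∈-filter⁺ (_∈? PQ σ) (∈-allFin y) y∈PQ)
      }
      where
      queue : List V
      queue = filter (_∈? PQ σ) (allFin n)

    progress : ∀ {σ} → Inv budget σ → ∃ λ γ → running σ ⟶ γ
    progress {σ} inv with any? (λ v → (v ∈? PQ σ) ×-dec (d σ v ≤⁺? P σ))
    ... | no none = _ , update (λ v∈PQ v≤P → none (_ , v∈PQ , v≤P))
    ... | yes (v , v∈PQ , v≤P) with minimum-exists σ v∈PQ
    ...   | u , min with u ∈? T
    ...     | yes u∈T = _ , stop min (≤⁺.trans (IsMinimum.least min v∈PQ) v≤P) u∈T
    ...     | no u∉T  = _ , iterate min (≤⁺.trans (IsMinimum.least min v∈PQ) v≤P) u∉T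
                          (proj₂ (finite-value (Core.PQ-labelled (Inv.core inv) (IsMinimum.queued min))))

    -- Every further call of Update-Prediction adds at least h to P, as P only grows.
    Fuel : ℕ → State → Set (c ⊔ ℓ₂)
    Fuel j σ = ∀ {p} → P σ ≡ [ p ] → ∃ λ h → h ≤ excess β *ᴷ p × weight p₀ ≤ p +ᴷ j ×ᴷ h

    -- The next update adds `excess β *ᴷ p`, which is positive; the archimedean axiom says how many
    -- such increments reach the weight of `p₀`. For infinite `P` the claim is vacuous.
    fuel : ∀ {σ} → Inv budget σ → ∃ λ j → Fuel j σ
    fuel {σ} inv with P σ | Core.P>0 (Inv.core inv)
    ... | ⊤⁺    | _   = 0 , λ ()
    ... | [ p ] | 0<p = proj₁ j , λ { refl → excess β *ᴷ p , ≤ᴷ.refl ,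
      ≤ᴷ.trans (proj₂ j) (≤ᴷ.trans (x≤x+y (<⇒≤ 0<p′)) (≤ᴷ.reflexive (K.+-comm _ _))) }
      where
      0<p′ : 0# < p
      0<p′ p≤0 = 0<p [ p≤0 ]
      j = archimedean (weight p₀) (*-pos (excess-pos 1<β) 0<p′)

    no-fuel : ∀ {σ} → Inv budget σ → LoopConditionFails σ → ¬ Fuel 0 σ
    no-fuel {σ} inv fails fuel₀ with P σ | P<target-walk (Inv.core inv) (Inv.bounded inv) fails t₀∈T p₀
    ... | ⊤⁺    | P<W = P<W (_ ≤⊤⁺)
    ... | [ p ] | P<W with fuel₀ refl
    ...   | _ , _ , W≤ = P<W [ ≤ᴷ.trans W≤ (≤ᴷ.reflexive (K.+-identityʳ p)) ]

    -- The increment `h` is kept: the update raises `P` by at least `h`, which uses one unit, and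
    -- `h` stays below the larger increment of the new `P`.
    use-fuel : ∀ {j σ} → Inv budget σ → Fuel (ℕ.suc j) σ → Fuel j (updatePrediction σ)
    use-fuel {j} {σ} inv fuelled eq with P σ | Core.P>0 (Inv.core inv)
    use-fuel {j} inv fuelled refl | [ p ] | 0<p with fuelled refl
    ... | h , h≤ , W≤ = h
      , ≤ᴷ.trans h≤ (≤ᴷ.trans (scale-≤ (<⇒≤ 1<β) εp≥0) (≤ᴷ.reflexive (begin
          β *ᴷ (excess β *ᴷ p)  ≈⟨ K.*-assoc _ _ _ ⟨
          β *ᴷ excess β *ᴷ p    ≈⟨ K.*-congʳ (K.*-comm _ _) ⟩
          excess β *ᴷ β *ᴷ p    ≈⟨ K.*-assoc _ _ _ ⟩
          excess β *ᴷ (β *ᴷ p)  ∎)))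
      , ≤ᴷ.trans W≤ (≤ᴷ.trans (≤ᴷ.reflexive (K.sym (K.+-assoc p h _)))
          (+-mono-≤ _ (≤ᴷ.trans (+-monoʳ-≤ p h≤) (≤ᴷ.reflexive (excess-* β p)))))
      where
      open import Relation.Binary.Reasoning.Setoid K.setoid
      εp≥0 : 0# ≤ excess β *ᴷ p
      εp≥0 = *-nonneg (<⇒≤ (excess-pos 1<β)) (<⇒≤ λ p≤0 → 0<p [ p≤0 ])

    unsettledCount : State → ℕ
    unsettledCount σ = ∑ λ v → when (unsettled? σ v) 1

    mutual

      -- Lexicographic descent: `i` bounds the unsettled nodes and falls with each iteration, while
      -- `j` bounds the updates before the next iteration and is chosen anew after it.
      accessible : ∀ i {σ} → Inv budget σ → unsettledCount σ ℕ.≤ i → Acc (flip _⟶_) (running σ)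
      accessible i inv count≤i with fuel inv
      ... | j , fuelled = accessible-fuelled i j inv count≤i fuelled

      accessible-fuelled : ∀ i j {σ} → Inv budget σ → unsettledCount σ ℕ.≤ i → Fuel j σ → Acc (flip _⟶_) (running σ)
      accessible-fuelled i j {σ} inv count≤i fuelled = acc (next i j count≤i fuelled)
        where
        next : ∀ i j → unsettledCount σ ℕ.≤ i → Fuel j σ → ∀ {γ} → running σ ⟶ γ → Acc (flip _⟶_) γ
        next i j count≤i fuelled (stop _ _ _) = acc λ ()
        next i ℕ.zero count≤i fuelled (update fails) = ⊥-elim (no-fuel inv fails fuelled)
        next i (ℕ.suc j) count≤i fuelled (update fails) =
          accessible-fuelled i j (Update.update-inv inv)
            (ℕ.≤-trans (∑-when-mono (unsettled? (updatePrediction σ)) (unsettled? σ) (const 1) (Update.unsettled⁻ inv)) count≤i)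
            (use-fuel {j} inv fuelled)
        next ℕ.zero j count≤i fuelled (iterate min u≤P u∉T label)
          with () ← ℕ.≤-trans (Iteration.fewer-unsettled inv min u≤P u∉T label) count≤i
        next (ℕ.suc i) j count≤i fuelled (iterate min u≤P u∉T label) =
          accessible i (Iteration.expand-inv inv min u≤P u∉T label)
            (ℕ.s≤s⁻¹ (ℕ.≤-trans (Iteration.fewer-unsettled inv min u≤P u∉T label) count≤i))

    terminates : Terminates
    terminates = accessible (unsettledCount initial) initial-inv ℕ.≤-refl , λ sts → progress-good (good sts)
      where
      progress-good : ∀ {σ} → Good (running σ) → ∃ λ γ → running σ ⟶ γ
      progress-good (running inv) = progress inv

    -- Optimality of the answer and the time bound

    some-execution : ∃ λ u → ∃ λ σ → start ⟶* stopped u σ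
    some-execution = run (proj₁ terminates) (running initial-inv)
      where
      run : ∀ {γ} → Acc (flip _⟶_) γ → Good γ → ∃ λ u → ∃ λ σ → γ ⟶* stopped u σ
      run a        (stopped _ _ _ _) = _ , _ , ε
      run (acc rs) (running inv) with progress inv
      ... | γ , st with run (rs st) (good-step (running inv) st)
      ...   | u , σ , sts = u , σ , st ◅ sts

    good-optimum : ∀ {u σ} → Good (stopped u σ) → ∃ λ D → IsOptimum D × d σ u ≈⁺ [ D ]
    good-optimum (stopped inv min u≤P u∈T)
      with finite-value (Core.PQ-labelled (Inv.core inv) (IsMinimum.queued min))
    ... | D , u≡D = D , optimum (Inv.core inv) (Inv.bounded inv) min u≤P u∈T u≈D , u≈D
      where u≈D = ≤⁺.Eq.reflexive u≡D

    good-solves : ∀ {u σ D} → Good (stopped u σ) → d σ u ≈⁺ [ D ] → Solves D u σ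
    good-solves (stopped inv min u≤P u∈T) u≈D = solves (Inv.core inv) (Inv.bounded inv) min u≤P u∈T u≈D

    -- Carries the optimum found in one execution over to all others, however ties are broken.
    optimum-unique : ∀ {D D′} → IsOptimum D → IsOptimum D′ → [ D ] ≈⁺ [ D′ ]
    optimum-unique o o′ = ≤⁺.antisym
      (IsOptimum.minimal o (IsOptimum.target∈T o′) (IsOptimum.attained o′))
      (IsOptimum.minimal o′ (IsOptimum.target∈T o) (IsOptimum.attained o))

    -- The optimum exists because some execution stops.
    computesOptimum : ComputesOptimum
    computesOptimum with good-optimum (good (proj₂ (proj₂ some-execution)))
    ... | D , optD , _ = D , optD , λ sts → all-solve (good sts)
      where
      all-solve : ∀ {u σ} → Good (stopped u σ) → Solves D u σ
      all-solve g with good-optimum g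
      ... | D′ , optD′ , u≈D′ = good-solves g (≤⁺.Eq.trans u≈D′ (optimum-unique optD′ optD))

    updatesOnlyBelowOptimum : UpdatesOnlyBelowOptimum
    updatesOnlyBelowOptimum {D} {σ} opt sts fails D≤P = below (good sts) (IsOptimum.attained opt)
      where
      below : Good (running σ) → ¬ IsDistance (IsOptimum.target opt) [ D ]
      below (running inv) (finite p p≈D _) =
        P<target-walk (Inv.core inv) (Inv.bounded inv) fails (IsOptimum.target∈T opt) (Path.walk p)
          (≤⁺.trans [ ≤ᴷ.reflexive p≈D ] D≤P)

    runningTime : RunningTime≤ (runningConstant * (1 + m + n * ⌈log₂ n ⌉))
    runningTime sts = ℕ.≤-trans (good-elapsed (good sts)) budget≤

theorem1 : ∀ {c ℓ₁ ℓ₂} (costs : UnitCosts) →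
    ∃ λ (C : ℕ) →
    (F : ArchimedeanOrderedField c ℓ₁ ℓ₂) (I : Instance F) (params : Parameters F) →
    Instance.TargetReachable I →
    DijkstraPrediction.Terminates F costs I params ×
    DijkstraPrediction.ComputesOptimum F costs I params ×
    DijkstraPrediction.UpdatesOnlyBelowOptimum F costs I params ×
    DijkstraPrediction.RunningTime≤ F costs I params
    (C * (1 + Instance.m I + Instance.n I * ⌈log₂ (Instance.n I) ⌉))
theorem1 costs = Costs.runningConstant costs , λ F I params reachable →
  Correctness.Initial.terminates costs F I params reachable ,
  Correctness.Initial.computesOptimum costs F I params reachable ,
  Correctness.Initial.updatesOnlyBelowOptimum costs F I params reachable ,
  Correctness.Initial.runningTime costs F I params reachable
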